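{- Let $R$ be a ring and let $P$ be a polygon divided into subpolygons $P^1,\ldots,P^{\kappa+1}$ by the dissection $E=\{(t_1,v_1),(v_1,t_1),\ldots,(t_\kappa,v_\kappa),(v_\kappa,t_\kappa)\}$ for some $\kappa\geqslant0$. For each $\alpha$ let $c^\alpha:\operatorname{diag}P^\alpha\to R^*$ be a frieze, and assume $c^\alpha_{tv}=c^\beta_{tv}$ whenever $(t,v)\in E\cap\operatorname{diag}P^\alpha\cap\operatorname{diag}P^\beta$. Then there exists a unique map $c:\operatorname{diag}P\to R$ such that (i) $c|_{\operatorname{diag}P^\alpha}=c^\alpha$ for each $\alpha$, and (ii) $c$ is a weak frieze with respect to $E$. Moreover, if this $c$ takes all its values in $R^*$, then $c$ is a frieze.
   Context: $R^*$ denotes the invertible elements of $R$. A polygon $P$ is a finite set of at least three vertices with a cyclic ordering (thought of as a convex polygon in the plane); a subpolygon is a subset of at least three vertices with the induced cyclic ordering. $\operatorname{diag}P$ is the set of ordered pairs of distinct vertices (diagonals). A diagonal is an edge if its endpoints are neighbours, otherwise internal. $(i,k)$ and $(j,\ell)$ cross if $i,j,k,\ell$ are pairwise distinct with $i<j<k<\ell$ or $i<\ell<k<j$ cyclically. A dissection is a set of internal diagonals closed under reversal with no two crossing; it divides $P$ into the subpolygons whose edges are diagonals in the dissection or edges of $P$. Write $c_{ik}=c(i,k)$, $c_{xx}=0$. A map $c:\operatorname{diag}P\to R^*$ is a frieze if for all pairwise distinct $i,j,k$: $c_{ij}c_{kj}^{ -1}c_{ki}=c_{ik}c_{jk}^{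 -1}c_{ji}$, and whenever $(i,k)$ and $(j,\ell)$ cross: $c_{ik}=c_{ij}c_{\ell j}^{ -1}c_{\ell k}+c_{i\ell}c_{j\ell}^{ -1}c_{jk}$. A map $c:\operatorname{diag}P\to R$ is a weak frieze with respect to a dissection $D$ if $c_{tv}\in R^*$ for $(t,v)\in D$ and whenever $(i,k)$ crosses $(t,v)$ with $(t,v),(v,t)\in D$, $c_{ik}=c_{it}c_{vt}^{ -1}c_{vk}+c_{iv}c_{tv}^{ -1}c_{tk}$. -}

module Defs where

open import Level using (Level; 0ℓ; _⊔_)
open import Algebra.Bundles using (Ring)
open import Algebra.Definitions using (Invertible)
open import Data.Nat.Base as ℕ using (ℕ; suc)
open import Data.Fin.Base using (Fin; _<_)
import Data.Fin.Properties as Fin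
open import Data.Fin.Subset using (Subset; _∈_; ⊤; ∣_∣)
open import Data.Fin.Subset.Properties using (∈⊤)
open import Data.Product.Base using (_×_; _,_; proj₁; ∃-syntax)
open import Data.Sum.Base using (_⊎_)
open import Function.Base using (_∘_)
open import Function.Definitions using (Injective)
open import Relation.Binary.Definitions using (DecidableEquality)
open import Relation.Binary.PropositionalEquality.Core using (_≡_; _≢_; refl; sym; cong)
open import Relation.Nullary.Decidable.Core using (yes; no; map′)
open import Relation.Nullary.Negation.Core using (¬_)
open import Relation.Unary using (Pred)

-- The vertices of the ambient polygon P are numbered 0, …, n - 1 in cyclic
-- order.  P itself is ⊤ : Subset n, and its subpolygons are the subsets with
-- at least three elements, with the induced cyclic order.

record Vertex {n : ℕ} (S : Subset n) : Set where
  constructor vertex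
  field
    label   : Fin n
    .label∈ : label ∈ S

open Vertex public

module _ {n : ℕ} {S : Subset n} where

  infix 4 _≟_

  _≟_ : DecidableEquality (Vertex S)
  i ≟ k = map′ (λ { refl → refl }) (cong label) (label i Fin.≟ label k)

  -- Starting at i and moving in the positive direction, one meets j strictly
  -- before k, and both before returning to i.
  Cyclic₃ : Vertex S → Vertex S → Vertex S → Set
  Cyclic₃ i j k = (label i < label j × label j < label k)
                ⊎ (label j < label k × label k < label i)
                ⊎ (label k < label i × label i < label j)

  -- i < j < k < ℓ cyclically.
  Cyclic₄ : Vertex S → Vertex S → Vertex S → Vertex S → Set
  Cyclic₄ i j k ℓ = Cyclic₃ i j k × Cyclic₃ i k ℓ

record Diagonal {n : ℕ} (S : Subset n) : Set where
  constructor diagonal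
  field
    src tgt   : Vertex S
    .distinct : src ≢ tgt

open Diagonal public

module _ {n : ℕ} {S : Subset n} where

  reverse : Diagonal S → Diagonal S
  reverse (diagonal i k i≢k) = diagonal k i (i≢k ∘ sym)

  Edge : Pred (Diagonal S) 0ℓ
  Edge (diagonal i k _) = (∀ j → ¬ Cyclic₃ i j k) ⊎ (∀ j → ¬ Cyclic₃ k j i)

  Internal : Pred (Diagonal S) 0ℓ
  Internal d = ¬ Edge d

  Cross : Diagonal S → Diagonal S → Set
  Cross (diagonal i k _) (diagonal j ℓ _) = Cyclic₄ i j k ℓ ⊎ Cyclic₄ i ℓ k j

  record IsDissection (D : Pred (Diagonal S) 0ℓ) : Set where
    field
      internal        : ∀ d → D d → Internal d
      reverse-closed  : ∀ d → D d → D (reverse d)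
      non-crossing    : ∀ d e → D d → D e → ¬ Cross d e

  -- {(t₁,v₁), (v₁,t₁), …, (tκ,vκ), (vκ,tκ)}
  SymmetricSet : {κ : ℕ} → (Fin κ → Diagonal S) → Pred (Diagonal S) 0ℓ
  SymmetricSet tv d = ∃[ α ] (d ≡ tv α ⊎ d ≡ reverse (tv α))

  PairwiseDistinct : {κ : ℕ} → (Fin κ → Diagonal S) → Set
  PairwiseDistinct tv = ∀ α β → (tv α ≡ tv β ⊎ tv α ≡ reverse (tv β)) → α ≡ β

module _ {n : ℕ} {S : Subset n} where

  embedᵛ : Vertex S → Vertex {n} ⊤
  embedᵛ (vertex x _) = vertex x ∈⊤

  embed : Diagonal S → Diagonal {n} ⊤
  embed (diagonal i k i≢k) =
    diagonal (embedᵛ i) (embedᵛ k) λ { refl → i≢k refl }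

-- The parts into which D divides P.  The last condition says that D does not
-- cut S any further; without it, P itself would always qualify, as would
-- every union of adjacent parts.
record IsPart {n : ℕ} (D : Pred (Diagonal {n} ⊤) 0ℓ) (S : Subset n) : Set where
  field
    polygon : 3 ℕ.≤ ∣ S ∣
    edges   : (d : Diagonal S) → Edge d → D (embed d) ⊎ Edge (embed d)
    uncut   : (d : Diagonal S) → Internal d → ¬ D (embed d)

record DividesInto {n m : ℕ} (D : Pred (Diagonal {n} ⊤) 0ℓ)
                   (P : Fin m → Subset n) : Set where
  field
    parts    : ∀ α → IsPart D (P α)
    distinct : Injective _≡_ _≡_ P
    all      : ∀ S → IsPart D S → ∃[ α ] P α ≡ S

module _ {a ℓ : Level} (R : Ring a ℓ) where
  open Ring R

  IsUnit : Carrier → Set (a ⊔ ℓ)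
  IsUnit = Invertible _≈_ 1# _*_

  inv : {x : Carrier} → IsUnit x → Carrier
  inv = proj₁

  module _ {n : ℕ} {S : Subset n} (c : Diagonal S → Carrier) where

    -- c i k, with the convention that c x x is 0.
    entry : Vertex S → Vertex S → Carrier
    entry i k with i ≟ k
    ... | yes _  = 0#
    ... | no i≢k = c (diagonal i k i≢k)

    record IsFrieze : Set (a ⊔ ℓ) where
      field
        unit     : ∀ d → IsUnit (c d)
        triangle : ∀ i j k → i ≢ j → (j≢k : j ≢ k) → i ≢ k →
                   let jk = diagonal j k j≢k in
                   entry i j * inv (unit (reverse jk)) * entry k i
                     ≈ entry i k * inv (unit jk) * entry j i
        exchange : ∀ d e → Cross d e →
                   let i = src d; k = tgt d; j = src e; l = tgt e in
                   c d ≈ entry i j * inv (unit (reverse e)) * entry l k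
                       + entry i l * inv (unit e) * entry j k

    record IsWeakFrieze (D : Pred (Diagonal S) 0ℓ) : Set (a ⊔ ℓ) where
      field
        unit     : ∀ d → D d → IsUnit (c d)
        exchange : ∀ d e → Cross d e → (e∈D : D e) (e′∈D : D (reverse e)) →
                   let i = src d; k = tgt d; t = src e; v = tgt e in
                   c d ≈ entry i t * inv (unit (reverse e) e′∈D) * entry v k
                       + entry i v * inv (unit e e∈D) * entry t k

  module _ {n m : ℕ} (D : Pred (Diagonal {n} ⊤) 0ℓ) (P : Fin m → Subset n)
           (cs : ∀ α → Diagonal (P α) → Carrier) where

    Compatible : Set ℓ
    Compatible = ∀ α β (d : Diagonal (P α)) (e : Diagonal (P β)) →
                 embed d ≡ embed e → D (embed d) → cs α d ≈ cs β e

    record IsGluing (c : Diagonal {n} ⊤ → Carrier) : Set (a ⊔ ℓ) where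
      field
        restricts  : ∀ α (d : Diagonal (P α)) → c (embed d) ≈ cs α d
        weakFrieze : IsWeakFrieze c D

{-# OPTIONS --safe #-}
module Submission where

-- Give c(i,k) the sign of k − i, and call the signed values m(i,k).  A unit-valued c is a frieze
-- iff m "factors through rank two": for all i ≠ k and all u, w,
--     m(u,w) = m(u,i) m(k,i)⁻¹ m(k,w) + m(u,k) m(i,k)⁻¹ m(i,w),
-- with no condition on the position of u and w.  A pair (i,k) with this property is a pivot, and
-- a pivot (t,v) can be exchanged for (t,j) as soon as m(t,j) and m(j,t) are units.
--
-- The parts are the cells cut off below the arcs (p,q), p < q, of the dissection, the pair
-- (0,n − 1) counting as an arc.  Working down from the cell below (0,n − 1), each vertex i gets
-- a row Y i and a column X i in R²; those of a vertex lying strictly inside a cell are read off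
-- from the two ends of its arc by means of the frieze of that cell.  The products Y u ⊙ X w are
-- the signed values of c, and exchanging pivots from cell to cell makes every diagonal of the
-- dissection a pivot, and further exchanges make every pair one if c has unit values.
-- Uniqueness holds because a pair of vertices in no common part is separated by the arc
-- of the part having one of them strictly inside.

open import Defs
open import Level using (Level; 0ℓ; _⊔_)
open import Algebra.Bundles using (Ring; CommutativeMonoid)
import Algebra.Properties.CommutativeSemigroup as CommutativeSemigroupProperties
import Algebra.Properties.Ring as RingProperties
open import Data.Empty using (⊥; ⊥-elim; ⊥-elim-irr)
open import Data.Fin.Base using (Fin; _<_; toℕ; fromℕ<) renaming (_≤_ to _≤ᶠ_)
import Data.Fin.Properties as Fin
open import Data.Fin.Subset using (Subset; inside; outside; ⊤; ∣_∣; _∈_; _∪_; ⁅_⁆) renaming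
  (_-_ to _∖_)
open import Data.Fin.Subset.Properties
  using (_∈?_; ∈⊤; ⊆-antisym; p⊆q⇒∣p∣≤∣q∣; ∣p∣≤∣x∷p∣; ∣⁅x⁆∣≡1; x∈⁅x⁆; x∈p∪q⁺; x∈p⇒∣p-x∣<∣p∣;
    x∈p∧x≢y⇒x∈p-y)
open import Data.Nat.Base as ℕ using (ℕ; suc; _≤_; _∸_; z≤n; s≤s)
open import Data.Nat.Induction using (<-wellFounded)
import Data.Nat.Properties as ℕ
open import Data.Product using (Σ; _×_; _,_; proj₁; proj₂; ∃; ∃!; ∃-syntax) renaming (swap to swap×)
open import Data.Sign.Base as Sign using (Sign; opposite) renaming (+ to ⊕; - to ⊖)
open import Data.Sum.Base using (_⊎_; inj₁; inj₂; swap)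
open import Data.Unit.Base using (tt) renaming (⊤ to ⊤ₜ)
open import Data.Vec.Base using ([]; _∷_; tabulate)
open import Data.Vec.Properties using (lookup⇒[]=; []=⇒lookup; lookup∘tabulate)
open import Function.Base using (_∘_)
open import Induction.WellFounded using (Acc; acc)
open import Relation.Binary.Definitions using (DecidableEquality; tri<; tri≈; tri>)
open import Relation.Binary.PropositionalEquality as ≡ using (_≡_; _≢_)
open import Relation.Nullary.Decidable
  using (Dec; yes; no; does; dec-true; map′; recompute; _×-dec_; _⊎-dec_; _→-dec_; ¬?)
open import Relation.Nullary.Negation.Core using (¬_)
open import Relation.Unary using (Pred)
open import Tactic.MonoidSolver using (solve)

-- The sign works because in each term of the identity the vertices i and k occur an even number of
-- times, u and w once each: the exchange relation keeps its form whichever vertex is numbered 0. At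
-- u = w the two terms get opposite signs and the left side is 0, which is the triangle relation. If
-- (u,w) and (i,k) do not cross, another pairing of the four vertices does, and its exchange
-- relation is solved for m(u,w).
--
-- The obstacle is that values between different parts need not be invertible. Pivots are therefore
-- exchanged inside one part at a time, where all values off the diagonal are units. Vectors
-- attached to vertices avoid a second difficulty: a value computed by crossing one diagonal of the
-- dissection after another might depend on their order. A vertex other than 0 and n - 1 lies
-- strictly inside exactly one cell, so its row and column involve no choice. The columns at 0 and n
-- - 1 are the standard basis of R²; the rows there are then forced by the frieze of the cell below
-- (0,n - 1).

sgn : ∀ {n} → Fin n → Fin n → Sign
sgn i j with i Fin.<? j
... | yes _ = ⊕
-- This includes i = j, where the sign is immaterial: it only multiplies the entry 0.
... | no  _ = ⊖

module _ {n : ℕ} where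

  sgn-< : {i j : Fin n} → i < j → sgn i j ≡ ⊕
  sgn-< {i} {j} i<j with i Fin.<? j
  ... | yes _   = ≡.refl
  ... | no  i≮j = ⊥-elim (i≮j i<j)

  sgn-> : {i j : Fin n} → j < i → sgn i j ≡ ⊖
  sgn-> {i} {j} j<i with i Fin.<? j
  ... | yes i<j = ⊥-elim (Fin.<-asym i<j j<i)
  ... | no  _   = ≡.refl

  sgn-swap : {i j : Fin n} → i ≢ j → sgn j i ≡ opposite (sgn i j)
  sgn-swap {i} {j} i≢j with Fin.<-cmp i j
  ... | tri< i<j _ _ rewrite sgn-< i<j | sgn-> i<j = ≡.refl
  ... | tri≈ _ i≡j _ = ⊥-elim (i≢j i≡j)
  ... | tri> _ _ j<i rewrite sgn-< j<i | sgn-> j<i = ≡.refl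

-- Cyclic order and the signs of crossing pairs

module _ {n : ℕ} {S : Subset n} where

  vertexSgn : Vertex S → Vertex S → Sign
  vertexSgn i j = sgn (label i) (label j)

  private
    variable
      i j k l : Vertex S

  label-≢ : i ≢ j → label i ≢ label j
  label-≢ i≢j ≡.refl = i≢j ≡.refl

  cyclic₃-total : i ≢ j → j ≢ k → i ≢ k → Cyclic₃ i j k ⊎ Cyclic₃ i k j
  cyclic₃-total {i} {j} {k} i≢j j≢k i≢k
    with Fin.<-cmp (label i) (label j) | Fin.<-cmp (label j) (label k) | Fin.<-cmp (label i)
      (label k)
  ... | tri≈ _ p _ | _ | _ = ⊥-elim (label-≢ i≢j p)
  ... | _ | tri≈ _ p _ | _ = ⊥-elim (label-≢ j≢k p)
  ... | _ | _ | tri≈ _ p _ = ⊥-elim (label-≢ i≢k p)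
  ... | tri< p _ _ | tri< q _ _ | _          = inj₁ (inj₁ (p , q))
  ... | tri< p _ _ | tri> _ _ q | tri< r _ _ = inj₂ (inj₁ (r , q))
  ... | tri< p _ _ | tri> _ _ q | tri> _ _ r = inj₁ (inj₂ (inj₂ (r , p)))
  ... | tri> _ _ p | tri< q _ _ | tri< r _ _ = inj₂ (inj₂ (inj₂ (p , r)))
  ... | tri> _ _ p | tri< q _ _ | tri> _ _ r = inj₁ (inj₂ (inj₁ (q , r)))
  ... | tri> _ _ p | tri> _ _ q | _          = inj₂ (inj₂ (inj₁ (q , p)))

  -- Four points on a circle form two pairs in three ways, and one of these crosses: the partner of
  -- `u` is the middle one of the other three, in the cyclic order starting at `u`. The cyclic
  -- comparisons determine which one it is.
  crossing-pairing : ∀ {u w} (u≢w : u ≢ w) (u≢i : u ≢ i) (u≢j : u ≢ j)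
                     (w≢i : w ≢ i) (w≢j : w ≢ j) (i≢j : i ≢ j) →
                     Cross (diagonal u w u≢w) (diagonal i j i≢j) ⊎
                     Cross (diagonal u i u≢i) (diagonal w j w≢j) ⊎
                     Cross (diagonal u j u≢j) (diagonal w i w≢i)
  crossing-pairing u≢w u≢i u≢j w≢i w≢j i≢j
    with cyclic₃-total u≢w w≢i u≢i | cyclic₃-total u≢i i≢j u≢j | cyclic₃-total u≢w w≢j u≢j
  ... | inj₁ uwi | inj₁ uij | _        = inj₂ (inj₁ (inj₁ (uwi , uij)))
  ... | inj₁ uwi | inj₂ uji | inj₁ uwj = inj₂ (inj₂ (inj₁ (uwj , uji)))
  ... | inj₁ uwi | inj₂ uji | inj₂ ujw = inj₁ (inj₂ (ujw , uwi))
  ... | inj₂ uiw | inj₁ uij | inj₁ uwj = inj₁ (inj₁ (uiw , uwj))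
  ... | inj₂ uiw | inj₁ uij | inj₂ ujw = inj₂ (inj₂ (inj₂ (uij , ujw)))
  ... | inj₂ uiw | inj₂ uji | _        = inj₂ (inj₁ (inj₂ (uji , uiw)))

  -- Moving the last label to the front reverses the sign of every pair containing that vertex. In
  -- each product `i` and `k` occur once and `j` and `l` twice, so both sides change alike and the
  -- rule for i < j < k < l survives rotation. Here the four rotations are checked one by one.
  cyclic₄-sgn : ∀ i j k l → Cyclic₄ i j k l →
                vertexSgn i k ≡ vertexSgn i j Sign.* vertexSgn l j Sign.* vertexSgn l k ×
                vertexSgn i k ≡ vertexSgn i l Sign.* vertexSgn j l Sign.* vertexSgn j k
  cyclic₄-sgn _ _ _ _ (inj₁ (ij , jk) , inj₁ (ik , kl))
    rewrite sgn-< ik | sgn-< ij | sgn-> (Fin.<-trans jk kl) | sgn-> kl | sgn-< (Fin.<-trans ik kl)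
      | sgn-< (Fin.<-trans jk kl) | sgn-< jk
    = ≡.refl , ≡.refl
  cyclic₄-sgn _ _ _ _ (inj₁ (ij , jk) , inj₂ (inj₁ (kl , li))) =
    ⊥-elim (Fin.<-asym (Fin.<-trans ij jk) (Fin.<-trans kl li))
  cyclic₄-sgn _ _ _ _ (inj₁ (ij , jk) , inj₂ (inj₂ (li , ik)))
    rewrite sgn-< ik | sgn-< ij | sgn-< (Fin.<-trans li ij) | sgn-< (Fin.<-trans li ik) | sgn-> li
      | sgn-> (Fin.<-trans li ij) | sgn-< jk
    = ≡.refl , ≡.refl
  cyclic₄-sgn _ _ _ _ (inj₂ (inj₁ (jk , ki)) , inj₁ (ik , kl)) = ⊥-elim (Fin.<-asym ki ik)
  cyclic₄-sgn _ _ _ _ (inj₂ (inj₁ (jk , ki)) , inj₂ (inj₁ (kl , li)))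
    rewrite sgn-> ki | sgn-> (Fin.<-trans jk ki) | sgn-> (Fin.<-trans jk kl) | sgn-> kl | sgn-> li
      | sgn-< (Fin.<-trans jk kl) | sgn-< jk
    = ≡.refl , ≡.refl
  cyclic₄-sgn _ _ _ _ (inj₂ (inj₁ (jk , ki)) , inj₂ (inj₂ (li , ik))) = ⊥-elim (Fin.<-asym ki ik)
  cyclic₄-sgn _ _ _ _ (inj₂ (inj₂ (ki , ij)) , inj₁ (ik , kl)) = ⊥-elim (Fin.<-asym ki ik)
  cyclic₄-sgn _ _ _ _ (inj₂ (inj₂ (ki , ij)) , inj₂ (inj₁ (kl , li)))
    rewrite sgn-> ki | sgn-< ij | sgn-< (Fin.<-trans li ij) | sgn-> kl | sgn-> li | sgn->
      (Fin.<-trans li ij) | sgn-> (Fin.<-trans ki ij)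
    = ≡.refl , ≡.refl
  cyclic₄-sgn _ _ _ _ (inj₂ (inj₂ (ki , ij)) , inj₂ (inj₂ (li , ik))) = ⊥-elim (Fin.<-asym ki ik)

  cross-sgn : ∀ i j k l (i≢k : i ≢ k) (j≢l : j ≢ l) → Cross (diagonal i k i≢k) (diagonal j l j≢l) →
              vertexSgn i k ≡ vertexSgn i j Sign.* vertexSgn l j Sign.* vertexSgn l k ×
              vertexSgn i k ≡ vertexSgn i l Sign.* vertexSgn j l Sign.* vertexSgn j k
  cross-sgn i j k l _ _ (inj₁ ijkl) = cyclic₄-sgn i j k l ijkl
  cross-sgn i j k l _ _ (inj₂ ilkj) =
    let p , q = cyclic₄-sgn i l k j ilkj in q , p

module _ {n : ℕ} {S : Subset n} where

  recompute-≢ : {i j : Vertex S} → .(i ≢ j) → i ≢ j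
  recompute-≢ {i} {j} i≢j with i ≟ j
  ... | yes i≡j = ⊥-elim-irr (i≢j i≡j)
  ... | no  i≢j = i≢j

-- Signed matrices and pivots

module SignedMatrices {a ℓ : Level} (R : Ring a ℓ) where
  open Ring R
  open RingProperties R
  open import Relation.Binary.Reasoning.Setoid setoid

  infixr 8 _·_

  _·_ : Sign → Carrier → Carrier
  ⊕ · x = x
  ⊖ · x = - x

  ·-cong : ∀ s {x y} → x ≈ y → s · x ≈ s · y
  ·-cong ⊕ x≈y = x≈y
  ·-cong ⊖ x≈y = -‿cong x≈y

  ·-congʳ : ∀ {s t} → s ≡ t → ∀ x → s · x ≈ t · x
  ·-congʳ ≡.refl x = refl

  ·-zero : ∀ s → s · 0# ≈ 0#
  ·-zero ⊕ = refl
  ·-zero ⊖ = -0#≈0#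

  ·-involutive : ∀ s x → s · s · x ≈ x
  ·-involutive ⊕ x = refl
  ·-involutive ⊖ x = -‿involutive x

  ·-opposite : ∀ s x → opposite s · x ≈ - (s · x)
  ·-opposite ⊕ x = refl
  ·-opposite ⊖ x = sym (-‿involutive x)

  ·-+ : ∀ s x y → s · (x + y) ≈ s · x + s · y
  ·-+ ⊕ x y = refl
  ·-+ ⊖ x y = sym (-‿+-comm x y)

  ·-* : ∀ s t x y → (s · x) * (t · y) ≈ (s Sign.* t) · (x * y)
  ·-* ⊕ ⊕ x y = refl
  ·-* ⊕ ⊖ x y = sym (-‿distribʳ-* x y)
  ·-* ⊖ ⊕ x y = sym (-‿distribˡ-* x y)
  ·-* ⊖ ⊖ x y = begin
    - x * - y     ≈⟨ -‿distribʳ-* (- x) y ⟨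
    - (- x * y)   ≈⟨ -‿cong (-‿distribˡ-* x y) ⟨
    - - (x * y)   ≈⟨ -‿involutive (x * y) ⟩
    x * y         ∎

  ·-*₃ : ∀ s t r x y z → (s · x) * (t · y) * (r · z) ≈ (s Sign.* t Sign.* r) · (x * y * z)
  ·-*₃ s t r x y z = trans (*-congʳ (·-* s t x y)) (·-* (s Sign.* t) r (x * y) z)

  module _ {x y : Carrier} (u : IsUnit R x) (v : IsUnit R y) where

    -- The inverse is part of the witness of invertibility, so witnesses of different origin have to
    -- be compared.
    inv-cong : x ≈ y → inv R u ≈ inv R v
    inv-cong x≈y = begin
      inv R u                  ≈⟨ *-identityʳ _ ⟨
      inv R u * 1#             ≈⟨ *-congˡ (proj₂ (proj₂ v)) ⟨
      inv R u * (y * inv R v)  ≈⟨ *-assoc _ _ _ ⟨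
      inv R u * y * inv R v    ≈⟨ *-congʳ (*-congˡ x≈y) ⟨
      inv R u * x * inv R v    ≈⟨ *-congʳ (proj₁ (proj₂ u)) ⟩
      1# * inv R v             ≈⟨ *-identityˡ _ ⟩
      inv R v                  ∎

  unit-cong : ∀ {x y} → x ≈ y → IsUnit R x → IsUnit R y
  unit-cong x≈y (x⁻¹ , l , r) = x⁻¹ , trans (*-congˡ (sym x≈y)) l , trans (*-congʳ (sym x≈y)) r

  unit-· : ∀ s {x} → IsUnit R x → IsUnit R (s · x)
  unit-· ⊕ u = u
  unit-· ⊖ {x} (x⁻¹ , l , r) = - x⁻¹ , trans (·-* ⊖ ⊖ x⁻¹ x) l , trans (·-* ⊖ ⊖ x x⁻¹) r

  inv-· : ∀ s {x} (u : IsUnit R x) → inv R (unit-· s u) ≡ s · inv R u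
  inv-· ⊕ u = ≡.refl
  inv-· ⊖ u = ≡.refl

  cancelˡ : ∀ {x} (u : IsUnit R x) y → x * inv R u * y ≈ y
  cancelˡ u y = trans (*-congʳ (proj₂ (proj₂ u))) (*-identityˡ y)

  cancelʳ : ∀ {x} (u : IsUnit R x) y → y * inv R u * x ≈ y
  cancelʳ u y = trans (*-assoc _ _ _) (trans (*-congˡ (proj₁ (proj₂ u))) (*-identityʳ y))

  x0y≈0 : ∀ {z} → z ≈ 0# → ∀ x y → x * z * y ≈ 0#
  x0y≈0 z≈0 x y = trans (*-congʳ (trans (*-congˡ z≈0) (zeroʳ x))) (zeroˡ y)

  0xy≈0 : ∀ {z} → z ≈ 0# → ∀ x y → z * x * y ≈ 0#
  0xy≈0 z≈0 x y = trans (*-congʳ (trans (*-congʳ z≈0) (zeroˡ x))) (zeroˡ y)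

  xy0≈0 : ∀ {z} → z ≈ 0# → ∀ x y → x * y * z ≈ 0#
  xy0≈0 z≈0 x y = trans (*-congˡ z≈0) (zeroʳ _)

  *₃-cong : ∀ {x x′ y y′ z z′} → x ≈ x′ → y ≈ y′ → z ≈ z′ → x * y * z ≈ x′ * y′ * z′
  *₃-cong p q r = *-cong (*-cong p q) r

  module _ {V : Set} (m : V → V → Carrier) where

    -- If `m` vanishes on the diagonal, its submatrix on rows and columns `i`, `j` is antidiagonal
    -- with invertible entries. The expansion then says that `m` is the product of its columns `i`,
    -- `j`, the inverse of this submatrix, and its rows `i`, `j`.
    record Pivot (i j : V) : Set (a ⊔ ℓ) where
      field
        unit    : IsUnit R (m i j)
        unitʳ   : IsUnit R (m j i)
        expand  : ∀ u w → m u w ≈ m u i * inv R unitʳ * m j w + m u j * inv R unit * m i w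

    open Pivot

    pivot-swap : ∀ {i j} → Pivot i j → Pivot j i
    pivot-swap p = record
      { unit = unitʳ p ; unitʳ = unit p
      ; expand = λ u w → trans (expand p u w) (+-comm _ _) }

    -- Expanding m(j,w) and m(u,j) at the old pivot (t,v) turns the right side into the expansion of
    -- m(u,w) at (t,v) plus an error term m(u,t) J z T m(t,w). Here z is the expansion of m(j,j),
    -- which is 0.
    pivot-change : ∀ {t v j} → m j j ≈ 0# → IsUnit R (m t j) → IsUnit R (m j t) →
                   Pivot t v → Pivot t j
    pivot-change {t} {v} {j} mjj≈0 tj jt p = record
      { unit = tj ; unitʳ = jt ; expand = λ u w → sym (begin
        m u t * J * m j w + m u j * T * m t w
          ≈⟨ +-cong (*-congˡ (expand p j w)) (*-congʳ (*-congʳ (expand p u j))) ⟩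
        m u t * J * (m j t * A * m v w + m j v * B * m t w) +
        (m u t * A * m v j + m u v * B * m t j) * T * m t w
          ≈⟨ +-cong (distribˡ _ _ _) (trans (*-congʳ (distribʳ _ _ _)) (distribʳ _ _ _)) ⟩
        (m u t * J * (m j t * A * m v w) + m u t * J * (m j v * B * m t w)) +
        (m u t * A * m v j * T * m t w + m u v * B * m t j * T * m t w)
          ≈⟨ +-cong (+-cong (first u w) (second u w)) (+-cong (third u w) (fourth u w)) ⟩
        (m u t * A * m v w + m u t * (J * (m j v * B * m t j) * T) * m t w) +
        (m u t * (J * (m j t * A * m v j) * T) * m t w + m u v * B * m t w)
          ≈⟨ +-assoc _ _ _ ⟩
        m u t * A * m v w + (m u t * (J * (m j v * B * m t j) * T) * m t w +
        (m u t * (J * (m j t * A * m v j) * T) * m t w + m u v * B * m t w))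
          ≈⟨ +-congˡ (+-assoc _ _ _) ⟨
        m u t * A * m v w + ((m u t * (J * (m j v * B * m t j) * T) * m t w +
        m u t * (J * (m j t * A * m v j) * T) * m t w) + m u v * B * m t w)
          ≈⟨ +-congˡ (+-congʳ (trans (sym (distribʳ _ _ _)) (*-congʳ (sym (distribˡ _ _ _))))) ⟩
        m u t * A * m v w + (m u t * (J * (m j v * B * m t j) * T + J * (m j t * A * m v j) * T) *
          m t w
          + m u v * B * m t w)
          ≈⟨ +-congˡ (+-congʳ (x0y≈0 vanish (m u t) (m t w))) ⟩
        m u t * A * m v w + (0# + m u v * B * m t w)
          ≈⟨ +-congˡ (+-identityˡ _) ⟩
        m u t * A * m v w + m u v * B * m t w
          ≈⟨ expand p u w ⟨
        m u w ∎) }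
      where
      A = inv R (unitʳ p)
      B = inv R (unit p)
      T = inv R tj
      J = inv R jt
      first : ∀ u w → m u t * J * (m j t * A * m v w) ≈ m u t * A * m v w
      first u w = begin
        m u t * J * (m j t * A * m v w)   ≈⟨ solve *-monoid ⟩
        m u t * J * m j t * (A * m v w)   ≈⟨ *-congʳ (cancelʳ jt _) ⟩
        m u t * (A * m v w)               ≈⟨ *-assoc _ _ _ ⟨
        m u t * A * m v w                 ∎
      second : ∀ u w → m u t * J * (m j v * B * m t w) ≈
        m u t * (J * (m j v * B * m t j) * T) * m t w
      second u w = begin
        m u t * J * (m j v * B * m t w)                  ≈⟨ *-congˡ (*-congˡ (cancelˡ tj _)) ⟨
        m u t * J * (m j v * B * (m t j * T * m t w))    ≈⟨ solve *-monoid ⟩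
        m u t * (J * (m j v * B * m t j) * T) * m t w    ∎
      third : ∀ u w → m u t * A * m v j * T * m t w ≈ m u t * (J * (m j t * A * m v j) * T) * m t w
      third u w = begin
        m u t * A * m v j * T * m t w
          ≈⟨ *-congʳ (*-congʳ (*-congʳ (*-congʳ (cancelʳ jt _)))) ⟨
        m u t * J * m j t * A * m v j * T * m t w        ≈⟨ solve *-monoid ⟩
        m u t * (J * (m j t * A * m v j) * T) * m t w    ∎
      fourth : ∀ u w → m u v * B * m t j * T * m t w ≈ m u v * B * m t w
      fourth u w = begin
        m u v * B * m t j * T * m t w     ≈⟨ solve *-monoid ⟩
        m u v * B * (m t j * T * m t w)   ≈⟨ *-congˡ (cancelˡ tj _) ⟩
        m u v * B * m t w                 ∎
      vanish : J * (m j v * B * m t j) * T + J * (m j t * A * m v j) * T ≈ 0#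
      vanish = trans (trans (sym (distribʳ _ _ _)) (*-congʳ (sym (distribˡ _ _ _))))
                     (x0y≈0 (trans (trans (+-comm _ _) (sym (expand p j j))) mjj≈0) J T)

    -- Two exchanges suffice: (p,q) to (p,i), then, after a swap, (i,p) to (i,j). Since the first
    -- one drops `q`, unit values are asked for only within `W`, which will be a part or the whole
    -- polygon.
    pivots : (∀ j → m j j ≈ 0#) → {W : V → Set} → (∀ {i j} → W i → W j → i ≢ j → IsUnit R (m i j)) →
             DecidableEquality V → ∀ {p q} → W p → Pivot p q →
             ∀ {i j} → W i → W j → i ≢ j → Pivot i j
    pivots m0 units _≟ᵥ_ {p} Wp pq {i} Wi Wj i≢j with p ≟ᵥ i
    ... | yes ≡.refl = pivot-change (m0 _) (units Wp Wj i≢j) (units Wj Wp (i≢j ∘ ≡.sym)) pq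
    ... | no  p≢i    = pivot-change (m0 _) (units Wi Wj i≢j) (units Wj Wi (i≢j ∘ ≡.sym))
      (pivot-swap (pivot-change (m0 _) (units Wp Wi p≢i) (units Wi Wp (p≢i ∘ ≡.sym)) pq))

    -- If `u` or `w` is one of `i`, `j`, one term vanishes and the other cancels to m(u,w). There
    -- remain u = w, the triangle identity, and the case of four distinct vertices.
    pivot-from : DecidableEquality V → (∀ j → m j j ≈ 0#) →
                 ∀ {i j} (ij : IsUnit R (m i j)) (ji : IsUnit R (m j i)) →
                 (∀ {w} → w ≢ i → w ≢ j → 0# ≈ m w i * inv R ji * m j w + m w j * inv R ij * m i w)
                   →
                 (∀ {u w} → u ≢ w → u ≢ i → u ≢ j → w ≢ i → w ≢ j →
                   m u w ≈ m u i * inv R ji * m j w + m u j * inv R ij * m i w) →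
                 Pivot i j
    pivot-from _≟ᵥ_ m0 {i} {j} ij ji tri generic =
      record { unit = ij ; unitʳ = ji ; expand = expanded }
      where
      expanded : ∀ u w → m u w ≈ m u i * inv R ji * m j w + m u j * inv R ij * m i w
      expanded u w with u ≟ᵥ i | u ≟ᵥ j | w ≟ᵥ i | w ≟ᵥ j | u ≟ᵥ w
      ... | yes ≡.refl | _ | _ | _ | _ =
        sym (trans (+-cong (0xy≈0 (m0 i) _ _) (cancelˡ ij _)) (+-identityˡ _))
      ... | no _ | yes ≡.refl | _ | _ | _ =
        sym (trans (+-cong (cancelˡ ji _) (0xy≈0 (m0 j) _ _)) (+-identityʳ _))
      ... | no _ | no _ | yes ≡.refl | _ | _ =
        sym (trans (+-cong (cancelʳ ji _) (xy0≈0 (m0 i) _ _)) (+-identityʳ _))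
      ... | no _ | no _ | no _ | yes ≡.refl | _ =
        sym (trans (+-cong (xy0≈0 (m0 j) _ _) (cancelʳ ij _)) (+-identityˡ _))
      ... | no u≢i | no u≢j | no _ | no _ | yes ≡.refl = trans (m0 u) (tri u≢i u≢j)
      ... | no u≢i | no u≢j | no w≢i | no w≢j | no u≢w = generic u≢w u≢i u≢j w≢i w≢j

    -- For the case in which (u,i) and (w,j) cross instead of (u,w) and (i,j). Multiplying the
    -- relation for m(u,i) on the right by m(j,i)⁻¹ m(j,w) isolates m(u,w); the triangle identity
    -- for `w`, `i`, `j` brings the rest into the required form.
    rotate : ∀ {u w i j} (ji : IsUnit R (m j i)) (ij : IsUnit R (m i j))
             (jw : IsUnit R (m j w)) (wj : IsUnit R (m w j)) →
             0# ≈ m w i * inv R ji * m j w + m w j * inv R ij * m i w →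
             m u i ≈ m u w * inv R jw * m j i + m u j * inv R wj * m w i →
             m u w ≈ m u i * inv R ji * m j w + m u j * inv R ij * m i w
    rotate {u} {w} {i} {j} ji ij jw wj tri ui = sym (begin
      m u i * I * m j w + m u j * B * m i w
        ≈⟨ +-congʳ (*-congʳ (*-congʳ ui)) ⟩
      (m u w * W * m j i + m u j * C * m w i) * I * m j w + m u j * B * m i w
        ≈⟨ +-congʳ (trans (*-congʳ (distribʳ _ _ _)) (distribʳ _ _ _)) ⟩
      (m u w * W * m j i * I * m j w + m u j * C * m w i * I * m j w) + m u j * B * m i w
        ≈⟨ +-cong (+-cong first middle) second ⟩
      (m u w + m u j * C * (m w i * I * m j w)) + m u j * C * (m w j * B * m i w)
        ≈⟨ +-assoc _ _ _ ⟩
      m u w + (m u j * C * (m w i * I * m j w) + m u j * C * (m w j * B * m i w))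
        ≈⟨ +-congˡ (distribˡ _ _ _) ⟨
      m u w + m u j * C * (m w i * I * m j w + m w j * B * m i w)
        ≈⟨ +-congˡ (xy0≈0 (sym tri) (m u j) C) ⟩
      m u w + 0#
        ≈⟨ +-identityʳ _ ⟩
      m u w ∎)
      where
      I = inv R ji
      B = inv R ij
      W = inv R jw
      C = inv R wj
      first : m u w * W * m j i * I * m j w ≈ m u w
      first = begin
        m u w * W * m j i * I * m j w     ≈⟨ solve *-monoid ⟩
        m u w * W * (m j i * I * m j w)   ≈⟨ *-congˡ (cancelˡ ji _) ⟩
        m u w * W * m j w                 ≈⟨ cancelʳ jw _ ⟩
        m u w                             ∎
      middle : m u j * C * m w i * I * m j w ≈ m u j * C * (m w i * I * m j w)
      middle = solve *-monoid
      second : m u j * B * m i w ≈ m u j * C * (m w j * B * m i w)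
      second = begin
        m u j * B * m i w                 ≈⟨ *-congʳ (*-congʳ (cancelʳ wj _)) ⟨
        m u j * C * m w j * B * m i w     ≈⟨ solve *-monoid ⟩
        m u j * C * (m w j * B * m i w)   ∎

  module _ {V : Set} {m m′ : V → V → Carrier} (m≈m′ : ∀ i j → m i j ≈ m′ i j) where

    pivot-cong : ∀ {i j} → Pivot m i j → Pivot m′ i j
    pivot-cong {i} {j} p = record
      { unit   = unit-cong (m≈m′ i j) unit
      ; unitʳ  = unit-cong (m≈m′ j i) unitʳ
      ; expand = λ u w → trans (sym (m≈m′ u w)) (trans (expand u w)
          (+-cong (*₃-cong (m≈m′ _ _) refl (m≈m′ _ _)) (*₃-cong (m≈m′ _ _) refl (m≈m′ _ _))))
      }
      where open Pivot p

  -- Translation between frieze relations and pivots of the signed matrix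

  module _ {n : ℕ} {S : Subset n} (c : Diagonal S → Carrier) where

    private
      variable
        i j k l : Vertex S

    entry-diag : ∀ i → entry R c i i ≈ 0#
    entry-diag i with i ≟ i
    ... | yes _  = refl
    ... | no i≢i = ⊥-elim (i≢i ≡.refl)

    entry-≢ : (i≢k : i ≢ k) → entry R c i k ≡ c (diagonal i k i≢k)
    entry-≢ {i} {k} i≢k with i ≟ k
    ... | yes i≡k = ⊥-elim (i≢k i≡k)
    ... | no  _   = ≡.refl

    entry-unit : (i≢k : i ≢ k) → IsUnit R (c (diagonal i k i≢k)) → IsUnit R (entry R c i k)
    entry-unit i≢k = ≡.subst (IsUnit R) (≡.sym (entry-≢ i≢k))

    signed : Vertex S → Vertex S → Carrier
    signed i k = vertexSgn i k · entry R c i k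

    signed-diag : ∀ i → signed i i ≈ 0#
    signed-diag i = trans (·-cong (vertexSgn i i) (entry-diag i)) (·-zero (vertexSgn i i))

    signed-unit : (∀ d → IsUnit R (c d)) → i ≢ k → IsUnit R (signed i k)
    signed-unit {i} {k} units i≢k = unit-· (vertexSgn i k) (entry-unit i≢k (units _))

    module _ {j l} (j≢l : j ≢ l)
             (u : IsUnit R (c (diagonal l j (j≢l ∘ ≡.sym)))) (v : IsUnit R (c (diagonal j l j≢l)))
             (u′ : IsUnit R (signed l j)) (v′ : IsUnit R (signed j l)) where

      inv-signed : (i≢k : i ≢ k) (x : IsUnit R (c (diagonal i k i≢k))) (y : IsUnit R (signed i k)) →
                   inv R y ≈ vertexSgn i k · inv R x
      inv-signed {i} {k} i≢k x y =
        trans (inv-cong y (unit-· (vertexSgn i k) x)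
          (·-cong (vertexSgn i k) (reflexive (entry-≢ i≢k))))
              (reflexive (inv-· (vertexSgn i k) x))

      signed-term₁ : ∀ i k → signed i j * inv R u′ * signed l k ≈
                     (vertexSgn i j Sign.* vertexSgn l j Sign.* vertexSgn l k) ·
                       (entry R c i j * inv R u * entry R c l k)
      signed-term₁ i k = trans (*-congʳ (*-congˡ (inv-signed (j≢l ∘ ≡.sym) u u′)))
        (·-*₃ (vertexSgn i j) (vertexSgn l j) (vertexSgn l k) _ _ _)

      signed-term₂ : ∀ i k → signed i l * inv R v′ * signed j k ≈
                     (vertexSgn i l Sign.* vertexSgn j l Sign.* vertexSgn j k) ·
                       (entry R c i l * inv R v * entry R c j k)
      signed-term₂ i k = trans (*-congʳ (*-congˡ (inv-signed j≢l v v′)))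
        (·-*₃ (vertexSgn i l) (vertexSgn j l) (vertexSgn j k) _ _ _)

      module _ {i k} (i≢k : i ≢ k) (cross : Cross (diagonal i k i≢k) (diagonal j l j≢l)) where

        signed-sum : signed i j * inv R u′ * signed l k + signed i l * inv R v′ * signed j k ≈
                     vertexSgn i k · (entry R c i j * inv R u * entry R c l k +
                                      entry R c i l * inv R v * entry R c j k)
        signed-sum = let p , q = cross-sgn i j k l i≢k j≢l cross in
          trans (+-cong (trans (signed-term₁ i k) (·-congʳ (≡.sym p) _))
                        (trans (signed-term₂ i k) (·-congʳ (≡.sym q) _)))
                (sym (·-+ (vertexSgn i k) _ _))

        exchange⇒expand :
          c (diagonal i k i≢k) ≈ entry R c i j * inv R u * entry R c l k +
                                 entry R c i l * inv R v * entry R c j k →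
          signed i k ≈ signed i j * inv R u′ * signed l k + signed i l * inv R v′ * signed j k
        exchange⇒expand e =
          trans (·-cong (vertexSgn i k) (trans (reflexive (entry-≢ i≢k)) e)) (sym signed-sum)

        expand⇒exchange :
          signed i k ≈ signed i j * inv R u′ * signed l k + signed i l * inv R v′ * signed j k →
          c (diagonal i k i≢k) ≈ entry R c i j * inv R u * entry R c l k +
                                 entry R c i l * inv R v * entry R c j k
        expand⇒exchange e = begin
          c (diagonal i k i≢k)                                    ≡⟨ entry-≢ i≢k ⟨
          entry R c i k
            ≈⟨ ·-involutive (vertexSgn i k) _ ⟨
          vertexSgn i k · vertexSgn i k · entry R c i k
            ≈⟨ ·-cong (vertexSgn i k) (trans e signed-sum) ⟩
          vertexSgn i k · vertexSgn i k · (entry R c i j * inv R u * entry R c l k +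
                                 entry R c i l * inv R v * entry R c j k)
                                                                  ≈⟨ ·-involutive (vertexSgn i k) _ ⟩
          entry R c i j * inv R u * entry R c l k + entry R c i l * inv R v * entry R c j k ∎

      module _ {i} (i≢j : i ≢ j) (i≢l : i ≢ l) where

        private
          s = vertexSgn i j Sign.* vertexSgn l j Sign.* vertexSgn l i
          t = vertexSgn i l Sign.* vertexSgn j l Sign.* vertexSgn j i

          -- Both products run over the three sides of the triangle, each side in opposite
          -- directions, so they differ by the cube of -1.
          opposite-signs : t ≡ opposite s
          opposite-signs
            rewrite sgn-swap (label-≢ i≢j) | sgn-swap (label-≢ i≢l) | sgn-swap (label-≢ j≢l)
            with vertexSgn i j | vertexSgn i l | vertexSgn j l
          ... | ⊕ | ⊕ | ⊕ = ≡.refl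
          ... | ⊕ | ⊕ | ⊖ = ≡.refl
          ... | ⊕ | ⊖ | ⊕ = ≡.refl
          ... | ⊕ | ⊖ | ⊖ = ≡.refl
          ... | ⊖ | ⊕ | ⊕ = ≡.refl
          ... | ⊖ | ⊕ | ⊖ = ≡.refl
          ... | ⊖ | ⊖ | ⊕ = ≡.refl
          ... | ⊖ | ⊖ | ⊖ = ≡.refl

          X = entry R c i j * inv R u * entry R c l i
          Y = entry R c i l * inv R v * entry R c j i

          signed-difference :
            signed i j * inv R u′ * signed l i + signed i l * inv R v′ * signed j i ≈ s · X - s · Y
          signed-difference = +-cong (signed-term₁ i i) (trans (signed-term₂ i i)
            (trans (·-congʳ opposite-signs Y) (·-opposite s Y)))

        triangle⇒expand : X ≈ Y →
          0# ≈ signed i j * inv R u′ * signed l i + signed i l * inv R v′ * signed j i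
        triangle⇒expand e = sym (trans signed-difference
          (trans (+-congʳ (·-cong s e)) (-‿inverseʳ (s · Y))))

        expand⇒triangle :
          0# ≈ signed i j * inv R u′ * signed l i + signed i l * inv R v′ * signed j i → X ≈ Y
        expand⇒triangle e = begin
          X            ≈⟨ ·-involutive s X ⟨
          s · s · X    ≈⟨ ·-cong s (x∙y⁻¹≈ε⇒x≈y (s · X) (s · Y) (sym (trans e signed-difference))) ⟩
          s · s · Y    ≈⟨ ·-involutive s Y ⟩
          Y            ∎

    frieze⇒pivot : IsFrieze R c → i ≢ j → Pivot signed i j
    frieze⇒pivot {i} {j} frieze i≢j =
      pivot-from signed _≟_ signed-diag (un i≢j) (un (≢-sym i≢j))
        (λ {w} w≢i w≢j → tri {w} w≢i w≢j i≢j) generic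
      where
      open IsFrieze frieze
      ≢-sym : ∀ {x y : Vertex S} → x ≢ y → y ≢ x
      ≢-sym x≢y = x≢y ∘ ≡.sym
      un : ∀ {i j} → i ≢ j → IsUnit R (signed i j)
      un = signed-unit unit
      tri : ∀ {w i j} (w≢i : w ≢ i) (w≢j : w ≢ j) (i≢j : i ≢ j) →
            0# ≈ signed w i * inv R (un (≢-sym i≢j)) * signed j w +
              signed w j * inv R (un i≢j) * signed i w
      tri {w} {i} {j} w≢i w≢j i≢j = triangle⇒expand i≢j (unit _) (unit _) (un (≢-sym i≢j)) (un i≢j)
        w≢i w≢j
        (triangle w i j w≢i i≢j w≢j)
      crossed : ∀ {u w i j} (u≢w : u ≢ w) (i≢j : i ≢ j) →
        Cross (diagonal u w u≢w) (diagonal i j i≢j) →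
            signed u w ≈ signed u i * inv R (un (≢-sym i≢j)) * signed j w +
              signed u j * inv R (un i≢j) * signed i w
      crossed u≢w i≢j x = exchange⇒expand i≢j (unit _) (unit _) (un (≢-sym i≢j)) (un i≢j) u≢w x
        (exchange (diagonal _ _ u≢w) (diagonal _ _ i≢j) x)
      generic : ∀ {u w} → u ≢ w → u ≢ i → u ≢ j → w ≢ i → w ≢ j →
            signed u w ≈ signed u i * inv R (un (≢-sym i≢j)) * signed j w +
              signed u j * inv R (un i≢j) * signed i w
      generic {u} {w} u≢w u≢i u≢j w≢i w≢j with crossing-pairing u≢w u≢i u≢j w≢i w≢j i≢j
      ... | inj₁ x = crossed {u} u≢w i≢j x
      ... | inj₂ (inj₁ x) = rotate signed {u} {w} {i} {j} (un (≢-sym i≢j)) (un i≢j)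
        (un (≢-sym w≢j)) (un w≢j)
              (tri {w} w≢i w≢j i≢j) (crossed {u} u≢i w≢j x)
      -- The previous case with `i` and `j` exchanged, which also exchanges the two summands.
      ... | inj₂ (inj₂ x) = trans (rotate signed {u} {w} {j} {i} (un i≢j) (un (≢-sym i≢j))
        (un (≢-sym w≢i)) (un w≢i)
              (tri {w} w≢j w≢i (≢-sym i≢j)) (crossed {u} u≢j w≢i x)) (+-comm _ _)

    pivots⇒frieze : (∀ d → IsUnit R (c d)) → (∀ {i j} → i ≢ j → Pivot signed i j) → IsFrieze R c
    pivots⇒frieze unit pivot = record
      { unit = unit
      ; triangle = λ i j k i≢j j≢k i≢k →
          let open Pivot (pivot j≢k) renaming (unit to unit′) in
          expand⇒triangle j≢k (unit _) (unit _) unitʳ unit′ i≢j i≢k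
            (trans (sym (signed-diag i)) (expand i i))
      ; exchange = λ { (diagonal i k i≢k) (diagonal j l j≢l) cross →
          let j≢l = recompute-≢ j≢l ; i≢k = recompute-≢ i≢k
              open Pivot (pivot j≢l) renaming (unit to unit′) in
          expand⇒exchange j≢l (unit _) (unit _) unitʳ unit′ i≢k cross (expand i k) }
      }

-- Extremal elements, spans, and counting in finite sets

module _ {A : Set} (f : A → ℕ) {P : A → Set} (below? : ∀ k → Dec (∃[ a ] P a × f a ℕ.< k)) where

  minimize : ∃ P → ∃[ a ] P a × (∀ b → P b → f a ℕ.≤ f b)
  minimize (a , Pa) = descend a Pa (<-wellFounded (f a))
    where
    descend : ∀ a → P a → Acc ℕ._<_ (f a) → ∃[ a ] P a × (∀ b → P b → f a ℕ.≤ f b)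
    descend a Pa (acc rs) with below? (f a)
    ... | yes (b , Pb , fb<fa) = descend b Pb (rs fb<fa)
    ... | no  none = a , Pa , λ b Pb → ℕ.≮⇒≥ λ fb<fa → none (b , Pb , fb<fa)

module _ {n : ℕ} where

  module _ {P : Fin n → Set} (P? : ∀ i → Dec (P i)) where

    least : ∃ P → ∃[ a ] P a × (∀ b → P b → a ≤ᶠ b)
    least = minimize toℕ λ k → Fin.any? λ a → P? a ×-dec toℕ a ℕ.<? k

    greatest : ∃ P → ∃[ a ] P a × (∀ b → P b → b ≤ᶠ a)
    greatest w =
      let a , Pa , a-min = minimize (λ i → n ∸ toℕ i) (λ k → Fin.any? λ a → P? a ×-dec n ∸ toℕ a ℕ.<? k) w in
      a , Pa , λ b Pb → ℕ.∸-cancelʳ-≤ (ℕ.<⇒≤ (Fin.toℕ<n b)) (a-min b Pb)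

    filter-subset : Subset n
    filter-subset = tabulate (does ∘ P?)

    filter-subset⁺ : ∀ {i} → P i → i ∈ filter-subset
    filter-subset⁺ {i} Pi = lookup⇒[]= i _ (≡.trans (lookup∘tabulate _ i) (dec-true (P? i) Pi))

    filter-subset⁻ : ∀ {i} → i ∈ filter-subset → P i
    filter-subset⁻ {i} i∈ with P? i | ≡.trans (≡.sym (lookup∘tabulate (does ∘ P?) i))
      ([]=⇒lookup i∈)
    ... | yes Pi | _ = Pi

  span : Fin n → Fin n → ℕ
  span p q = toℕ q ∸ toℕ p

  narrowest : {P : Fin n → Fin n → Set} → (∀ p q → Dec (P p q)) → ∀ {p q} → P p q →
              ∃[ a ] ∃[ b ] P a b × (∀ p q → P p q → span a b ℕ.≤ span p q)
  narrowest {P} P? {p} {q} Ppq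
    with minimize {A = Fin n × Fin n} (λ (a , b) → span a b) {P = λ (a , b) → P a b} below?
      ((p , q) , Ppq)
    where
    below? : ∀ k → Dec (∃[ ab ] P (proj₁ ab) (proj₂ ab) × span (proj₁ ab) (proj₂ ab) ℕ.< k)
    below? k with Fin.any? (λ a → Fin.any? λ b → P? a b ×-dec span a b ℕ.<? k)
    ... | yes (a , b , w) = yes ((a , b) , w)
    ... | no  none        = no λ { ((a , b) , w) → none (a , b , w) }
  ... | (a , b) , Pab , ab-min = a , b , Pab , λ p q Ppq → ab-min (p , q) Ppq

  module _ {p q t v : Fin n} (p≤t : p ≤ᶠ t) (t<v : t < v) (v≤q : v ≤ᶠ q) where

    span-< : ¬ (t ≡ p × v ≡ q) → span t v ℕ.< span p q
    span-< distinct with ℕ.m≤n⇒m<n∨m≡n p≤t | ℕ.m≤n⇒m<n∨m≡n v≤q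
    ... | inj₁ p<t | _ = ℕ.≤-<-trans (ℕ.∸-monoˡ-≤ (toℕ t) v≤q)
                           (ℕ.∸-monoʳ-< p<t (ℕ.≤-trans (ℕ.<⇒≤ t<v) v≤q))
    ... | inj₂ _   | inj₁ v<q = ℕ.<-≤-trans (ℕ.∸-monoˡ-< v<q (ℕ.<⇒≤ t<v)) (ℕ.∸-monoʳ-≤ (toℕ q) p≤t)
    ... | inj₂ p≡t | inj₂ v≡q =
      ⊥-elim (distinct (≡.sym (Fin.toℕ-injective p≡t) , Fin.toℕ-injective v≡q))

    -- How visibility is obtained from minimality: an arc nested in a narrowest arc of some kind,
    -- and itself of that kind, is that arc.
    span-≤⇒≡ : span p q ℕ.≤ span t v → t ≡ p × v ≡ q
    span-≤⇒≡ le with t Fin.≟ p | v Fin.≟ q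
    ... | yes t≡p | yes v≡q = t≡p , v≡q
    ... | yes _   | no  v≢q = ⊥-elim (ℕ.<⇒≱ (span-< (v≢q ∘ proj₂)) le)
    ... | no  t≢p | _       = ⊥-elim (ℕ.<⇒≱ (span-< (t≢p ∘ proj₁)) le)

∣p∪q∣≤∣p∣+∣q∣ : ∀ {n} (p q : Subset n) → ∣ p ∪ q ∣ ℕ.≤ ∣ p ∣ ℕ.+ ∣ q ∣
∣p∪q∣≤∣p∣+∣q∣ []            []            = z≤n
∣p∪q∣≤∣p∣+∣q∣ (inside  ∷ p) (t       ∷ q) =
  s≤s (ℕ.≤-trans (∣p∪q∣≤∣p∣+∣q∣ p q) (ℕ.+-monoʳ-≤ ∣ p ∣ (∣p∣≤∣x∷p∣ t q)))
∣p∪q∣≤∣p∣+∣q∣ (outside ∷ p) (inside  ∷ q) =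
  ℕ.≤-trans (s≤s (∣p∪q∣≤∣p∣+∣q∣ p q)) (ℕ.≤-reflexive (≡.sym (ℕ.+-suc ∣ p ∣ ∣ q ∣)))
∣p∪q∣≤∣p∣+∣q∣ (outside ∷ p) (outside ∷ q) = ∣p∪q∣≤∣p∣+∣q∣ p q

module _ {n : ℕ} {S : Subset n} where

  third-element : 3 ℕ.≤ ∣ S ∣ → ∀ p q → ∃[ j ] j ∈ S × j ≢ p × j ≢ q
  third-element 3≤∣S∣ p q with Fin.any? (λ j → (j ∈? S) ×-dec ¬? (j Fin.≟ p) ×-dec ¬? (j Fin.≟ q))
  ... | yes found = found
  ... | no  none  = ⊥-elim (ℕ.<⇒≱ 3≤∣S∣ (begin
    ∣ S ∣                   ≤⟨ p⊆q⇒∣p∣≤∣q∣ S⊆ ⟩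
    ∣ ⁅ p ⁆ ∪ ⁅ q ⁆ ∣       ≤⟨ ∣p∪q∣≤∣p∣+∣q∣ ⁅ p ⁆ ⁅ q ⁆ ⟩
    ∣ ⁅ p ⁆ ∣ ℕ.+ ∣ ⁅ q ⁆ ∣ ≡⟨ ≡.cong₂ ℕ._+_ (∣⁅x⁆∣≡1 p) (∣⁅x⁆∣≡1 q) ⟩
    2                       ∎))
    where
    open ℕ.≤-Reasoning
    S⊆ : ∀ {j} → j ∈ S → j ∈ ⁅ p ⁆ ∪ ⁅ q ⁆
    S⊆ {j} j∈S with j Fin.≟ p | j Fin.≟ q
    ... | yes ≡.refl | _          = x∈p∪q⁺ (inj₁ (x∈⁅x⁆ p))
    ... | no  _      | yes ≡.refl = x∈p∪q⁺ {p = ⁅ p ⁆} (inj₂ (x∈⁅x⁆ q))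
    ... | no  j≢p    | no  j≢q    = ⊥-elim (none (j , j∈S , j≢p , j≢q))

  three-elements : ∀ {i j k} → i ∈ S → j ∈ S → k ∈ S → j ≢ i → k ≢ i → k ≢ j → 3 ℕ.≤ ∣ S ∣
  three-elements {i} {j} {k} i∈S j∈S k∈S j≢i k≢i k≢j = begin
    3                      ≤⟨ s≤s (s≤s (s≤s z≤n)) ⟩
    3 ℕ.+ ∣ S ∖ i ∖ j ∖ k ∣ ≤⟨ s≤s (s≤s (x∈p⇒∣p-x∣<∣p∣
      (x∈p∧x≢y⇒x∈p-y (x∈p∧x≢y⇒x∈p-y k∈S k≢i) k≢j))) ⟩
    2 ℕ.+ ∣ S ∖ i ∖ j ∣     ≤⟨ s≤s (x∈p⇒∣p-x∣<∣p∣ (x∈p∧x≢y⇒x∈p-y j∈S j≢i)) ⟩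
    1 ℕ.+ ∣ S ∖ i ∣         ≤⟨ x∈p⇒∣p-x∣<∣p∣ i∈S ⟩
    ∣ S ∣                   ∎
    where open ℕ.≤-Reasoning

  <⇒≢ : {i k : Vertex S} → label i < label k → i ≢ k
  <⇒≢ i<k i≡k = Fin.<⇒≢ i<k (≡.cong label i≡k)

  module _ (i k : Vertex S) (i<k : label i < label k) where

    edge-between : (∀ (j : Vertex S) → label i < label j → label j < label k → ⊥) →
      Edge (diagonal i k (<⇒≢ i<k))
    edge-between none = inj₁ λ
      { j (inj₁ (ij , jk))        → none j ij jk
      ; j (inj₂ (inj₁ (jk , ki))) → ℕ.<-asym i<k ki
      ; j (inj₂ (inj₂ (ki , ij))) → ℕ.<-asym i<k ki }

    edge-around : (∀ (j : Vertex S) → label i ≤ᶠ label j × label j ≤ᶠ label k) →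
      Edge (diagonal i k (<⇒≢ i<k))
    edge-around all = inj₂ λ
      { j (inj₁ (kj , ji))        → ℕ.<⇒≱ kj (proj₂ (all j))
      ; j (inj₂ (inj₁ (ji , ik))) → ℕ.<⇒≱ ji (proj₁ (all j))
      ; j (inj₂ (inj₂ (ik , kj))) → ℕ.<⇒≱ kj (proj₂ (all j)) }

    edge-cases : Edge (diagonal i k (<⇒≢ i<k)) →
                 (∀ (j : Vertex S) → label i < label j → label j < label k → ⊥) ⊎
                 (∀ (j : Vertex S) → label i ≤ᶠ label j × label j ≤ᶠ label k)
    edge-cases (inj₁ none) = inj₁ λ j ij jk → none j (inj₁ (ij , jk))
    edge-cases (inj₂ none) = inj₂ λ j →
      ℕ.≮⇒≥ (λ ji → none j (inj₂ (inj₁ (ji , i<k)))) ,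
        ℕ.≮⇒≥ (λ kj → none j (inj₂ (inj₂ (i<k , kj))))

vertex-≡ : ∀ {n} {S : Subset n} {i k : Vertex S} → label i ≡ label k → i ≡ k
vertex-≡ ≡.refl = ≡.refl

member : ∀ {n} {S : Subset n} (i : Vertex S) → label i ∈ S
member {S = S} (vertex x x∈S) = recompute (x ∈? S) x∈S

-- Parts as cells below arcs

module Arcs {n : ℕ} (3≤n : 3 ℕ.≤ n) {D : Pred (Diagonal {n} ⊤) 0ℓ}
            (D? : ∀ d → Dec (D d)) (dissection : IsDissection D) where

  open IsDissection dissection

  private
    variable
      a i j p q t v : Fin n

  ⟨_⟩ : Fin n → Vertex {n} ⊤
  ⟨ i ⟩ = vertex i ∈⊤

  chord : .(p < q) → Diagonal {n} ⊤
  chord {p} {q} p<q = diagonal ⟨ p ⟩ ⟨ q ⟩ (<⇒≢ p<q)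

  -- Describes (0,n - 1) by its bounding property, so that these elements of `Fin n` need not be
  -- named.
  Outer : Fin n → Fin n → Set
  Outer p q = ∀ (j : Fin n) → p ≤ᶠ j × j ≤ᶠ q

  Arc : Fin n → Fin n → Set
  Arc p q = Σ (p < q) λ p<q → Outer p q ⊎ D (chord p<q)

  arc? : ∀ p q → Dec (Arc p q)
  arc? p q with p Fin.<? q
  ... | no  p≮q = no (p≮q ∘ proj₁)
  ... | yes p<q = map′ (p<q ,_) (λ { (p<q , kind) → kind })
    (Fin.all? (λ j → p Fin.≤? j ×-dec j Fin.≤? q) ⊎-dec D? (chord p<q))

  chord-inner : (p<q : p < q) → D (chord p<q) → ¬ Outer p q
  chord-inner p<q d outer = internal _ d (edge-around ⟨ _ ⟩ ⟨ _ ⟩ p<q (λ j → outer (label j)))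

  arcs-nest : ∀ {b} → Arc t v → Arc a b → t < a → a < v → v < b → ⊥
  arcs-nest {b = b} (_ , inj₁ o) _ _ _ v<b = ℕ.<⇒≱ v<b (proj₂ (o b))
  arcs-nest {t = t} (_ , inj₂ _) (_ , inj₁ o) t<a _ _ = ℕ.<⇒≱ t<a (proj₁ (o t))
  arcs-nest (t<v , inj₂ d) (a<b , inj₂ e) t<a a<v v<b =
    non-crossing _ _ d e (inj₁ (inj₁ (t<a , a<v) , inj₁ (t<v , v<b)))

  -- Gives every cell a third vertex: for the outer pair because n is at least 3, for a diagonal of
  -- `D` because it is internal.
  arc-long : Arc p q → suc (toℕ p) ℕ.< toℕ q
  arc-long {p} {q} (p<q , inj₁ o) = begin-strict
    suc (toℕ p)    ≤⟨ s≤s (proj₁ (o (fromℕ< 0<n))) ⟩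
    suc (toℕ (fromℕ< 0<n)) ≡⟨ ≡.cong suc (Fin.toℕ-fromℕ< 0<n) ⟩
    1              <⟨ s≤s (s≤s z≤n) ⟩
    2              ≡⟨ Fin.toℕ-fromℕ< 3≤n ⟨
    toℕ (fromℕ< 3≤n) ≤⟨ proj₂ (o (fromℕ< 3≤n)) ⟩
    toℕ q          ∎
    where
    open ℕ.≤-Reasoning
    0<n : 0 ℕ.< n
    0<n = ℕ.≤-trans (s≤s z≤n) 3≤n
  arc-long {p} {q} (p<q , inj₂ d) = ℕ.≤∧≢⇒< p<q λ 1+p≡q →
    internal _ d (edge-between ⟨ _ ⟩ ⟨ _ ⟩ p<q λ j p<j j<q →
      ℕ.<⇒≱ j<q (ℕ.≤-trans (ℕ.≤-reflexive (≡.sym 1+p≡q)) p<j))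

  -- No arc below (p,q), other than (p,q) itself, passes over j: these j are the vertices of the
  -- part lying directly below (p,q).
  Visible : Fin n → Fin n → Fin n → Set
  Visible p q j = p ≤ᶠ j × j ≤ᶠ q ×
    (∀ t v → Arc t v → p ≤ᶠ t → t < j → j < v → v ≤ᶠ q → t ≡ p × v ≡ q)

  visible? : ∀ p q j → Dec (Visible p q j)
  visible? p q j = p Fin.≤? j ×-dec j Fin.≤? q ×-dec Fin.all? λ t → Fin.all? λ v →
    arc? t v →-dec p Fin.≤? t →-dec t Fin.<? j →-dec j Fin.<? v →-dec v Fin.≤? q →-dec
      (t Fin.≟ p ×-dec v Fin.≟ q)

  visible-src : p ≤ᶠ q → Visible p q p
  visible-src p≤q = ℕ.≤-refl , p≤q , λ t v _ p≤t t<p _ _ → ⊥-elim (ℕ.<⇒≱ t<p p≤t)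

  visible-tgt : p ≤ᶠ q → Visible p q q
  visible-tgt p≤q = p≤q , ℕ.≤-refl , λ t v _ _ _ q<v v≤q → ⊥-elim (ℕ.<⇒≱ q<v v≤q)

  abstract

    cell : Fin n → Fin n → Subset n
    cell p q = filter-subset (visible? p q)

    cell⁺ : Visible p q j → j ∈ cell p q
    cell⁺ {p} {q} = filter-subset⁺ (visible? p q)

    cell⁻ : j ∈ cell p q → Visible p q j
    cell⁻ {p = p} {q = q} = filter-subset⁻ (visible? p q)

  module _ {p q : Fin n} (pq : Arc p q) where

    -- The boundary of the cell is walked from `a` along the longest arc starting there, apart from
    -- (p,q) itself, and by a step to a + 1 if there is none. An arc other than (p,q) over the new
    -- vertex would also pass over `a`, cross the chosen arc, or be a better choice.
    next-visible : Visible p q a → a < q →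
                   ∃[ b ] a < b × Visible p q b × (toℕ b ≡ suc (toℕ a) ⊎ Arc a b ×
                     ¬ (a ≡ p × b ≡ q))
    next-visible {a = a} (p≤a , a≤q , a-vis) a<q
      with Fin.any? (λ v → arc? a v ×-dec v Fin.≤? q ×-dec ¬? (a Fin.≟ p ×-dec v Fin.≟ q))
    ... | no none = b , ℕ.≤-reflexive (≡.sym b≡1+a) , (p≤b , b≤q , b-vis) , inj₁ b≡1+a
      where
      1+a<n = ℕ.≤-<-trans a<q (Fin.toℕ<n q)
      b = fromℕ< 1+a<n
      b≡1+a : toℕ b ≡ suc (toℕ a)
      b≡1+a = Fin.toℕ-fromℕ< 1+a<n
      a≤b : a ≤ᶠ b
      a≤b = ℕ.≤-trans (ℕ.n≤1+n _) (ℕ.≤-reflexive (≡.sym b≡1+a))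
      p≤b : p ≤ᶠ b
      p≤b = ℕ.≤-trans p≤a a≤b
      b≤q : b ≤ᶠ q
      b≤q = ℕ.≤-trans (ℕ.≤-reflexive b≡1+a) a<q
      b-vis : ∀ t v → Arc t v → p ≤ᶠ t → t < b → b < v → v ≤ᶠ q → t ≡ p × v ≡ q
      b-vis t v tv p≤t t<b b<v v≤q with ℕ.m≤n⇒m<n∨m≡n
        (ℕ.≤-pred (ℕ.≤-trans t<b (ℕ.≤-reflexive b≡1+a)))
      ... | inj₁ t<a = a-vis t v tv p≤t t<a (ℕ.≤-<-trans a≤b b<v) v≤q
      ... | inj₂ t≡a with Fin.toℕ-injective t≡a
      ...   | ≡.refl with t Fin.≟ p ×-dec v Fin.≟ q
      ...     | yes tv≡pq = tv≡pq
      ...     | no  tv≢pq = ⊥-elim (none (v , tv , v≤q , tv≢pq))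
    ... | yes some with greatest (λ v → arc? a v ×-dec v Fin.≤? q ×-dec ¬?
      (a Fin.≟ p ×-dec v Fin.≟ q)) some
    ...   | b , (ab , b≤q , ab≢pq) , b-max =
      b , a<b , (ℕ.≤-trans p≤a (ℕ.<⇒≤ a<b) , b≤q , b-vis) , inj₂ (ab , ab≢pq)
      where
      a<b = proj₁ ab
      b-vis : ∀ t v → Arc t v → p ≤ᶠ t → t < b → b < v → v ≤ᶠ q → t ≡ p × v ≡ q
      b-vis t v tv p≤t t<b b<v v≤q with Fin.<-cmp t a
      ... | tri< t<a _ _ = a-vis t v tv p≤t t<a (ℕ.<-trans a<b b<v) v≤q
      ... | tri> _ _ a<t = ⊥-elim (arcs-nest ab tv a<t t<b b<v)
      ... | tri≈ _ ≡.refl _ with t Fin.≟ p ×-dec v Fin.≟ q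
      ...   | yes tv≡pq = tv≡pq
      ...   | no  tv≢pq = ⊥-elim (ℕ.<⇒≱ b<v (b-max v (tv , v≤q , tv≢pq)))

    private
      p<q = proj₁ pq
      p-visible = visible-src (ℕ.<⇒≤ p<q)
      q-visible = visible-tgt (ℕ.<⇒≤ p<q)

    cell-polygon : 3 ℕ.≤ ∣ cell p q ∣
    cell-polygon with next-visible p-visible p<q
    ... | b , p<b , b-visible , step =
      three-elements (cell⁺ p-visible) (cell⁺ b-visible) (cell⁺ q-visible)
        (Fin.<⇒≢ p<b ∘ ≡.sym) (Fin.<⇒≢ p<q ∘ ≡.sym) (λ { ≡.refl → b≢q step })
      where
      b≢q : ¬ (toℕ q ≡ suc (toℕ p) ⊎ Arc p q × ¬ (p ≡ p × q ≡ q))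
      b≢q (inj₁ q≡1+p)   = ℕ.<-irrefl (≡.sym q≡1+p) (arc-long pq)
      b≢q (inj₂ (_ , ≢)) = ≢ (≡.refl , ≡.refl)

    -- An edge that encloses the whole cell is (p,q). Otherwise `y` must be the vertex `b` after `x`
    -- found by `next-visible`: b < y contradicts adjacency, and for y < b the arc from `x` to `b`
    -- would hide `y`.
    cell-edge : ∀ {x y} (x∈ : x ∈ cell p q) (y∈ : y ∈ cell p q) (x<y : x < y)
      .(x≢y : vertex x x∈ ≢ vertex y y∈) →
                Edge (diagonal (vertex x x∈) (vertex y y∈) x≢y) → D (chord x<y) ⊎ Edge (chord x<y)
    cell-edge {x} {y} x∈ y∈ x<y x≢y e with edge-cases (vertex x x∈) (vertex y y∈) x<y e
    ... | inj₂ around = from-arc arc-xy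
      where
      arc-xy : Arc x y
      arc-xy = ≡.subst₂ Arc
        (Fin.≤-antisym (proj₁ (cell⁻ x∈)) (proj₁ (around (vertex p (cell⁺ p-visible)))))
        (Fin.≤-antisym (proj₂ (around (vertex q (cell⁺ q-visible)))) (proj₁ (proj₂ (cell⁻ y∈))))
        pq
      from-arc : Arc x y → _
      from-arc (_ , inj₁ o) = inj₂ (edge-around ⟨ x ⟩ ⟨ y ⟩ x<y λ j → o (label j))
      from-arc (_ , inj₂ d) = inj₁ d
    ... | inj₁ between with next-visible (cell⁻ x∈) (ℕ.<-≤-trans x<y (proj₁ (proj₂ (cell⁻ y∈))))
    ...   | b , x<b , b-vis , step with Fin.<-cmp b y
    ...     | tri< b<y _ _ = ⊥-elim (between (vertex b (cell⁺ b-vis)) x<b b<y)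
    ...     | tri> _ _ y<b = ⊥-elim (overshoot step)
      where
      overshoot : ¬ (toℕ b ≡ suc (toℕ x) ⊎ Arc x b × ¬ (x ≡ p × b ≡ q))
      overshoot (inj₁ b≡1+x)   = ℕ.<⇒≱ y<b (ℕ.≤-trans (ℕ.≤-reflexive b≡1+x) x<y)
      overshoot (inj₂ (xb , ≢)) =
        ≢ (proj₂ (proj₂ (cell⁻ y∈)) x b xb (proj₁ (cell⁻ x∈)) x<y y<b (proj₁ (proj₂ b-vis)))
    ...     | tri≈ _ ≡.refl _ = reached step
      where
      reached : toℕ b ≡ suc (toℕ x) ⊎ Arc x b × ¬ (x ≡ p × b ≡ q) → _
      reached (inj₁ b≡1+x) = inj₂ (edge-between ⟨ x ⟩ ⟨ y ⟩ x<y λ j x<j j<b →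
        ℕ.<⇒≱ j<b (ℕ.≤-trans (ℕ.≤-reflexive b≡1+x) x<j))
      reached (inj₂ ((_ , inj₁ o) , _)) = inj₂ (edge-around ⟨ x ⟩ ⟨ y ⟩ x<y λ j → o (label j))
      reached (inj₂ ((_ , inj₂ d) , _)) = inj₁ d

    -- A diagonal of `D` between two vertices of the cell, other than (p,q), hides everything
    -- strictly below it, so its ends are neighbours in the cell.
    cell-uncut : ∀ {x y} (x∈ : x ∈ cell p q) (y∈ : y ∈ cell p q) (x<y : x < y)
      .(x≢y : vertex x x∈ ≢ vertex y y∈) →
                 Internal (diagonal (vertex x x∈) (vertex y y∈) x≢y) → ¬ D (chord x<y)
    cell-uncut {x} {y} x∈ y∈ x<y x≢y int d with x Fin.≟ p ×-dec y Fin.≟ q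
    ... | yes (≡.refl , ≡.refl) = int (edge-around (vertex x x∈) (vertex y y∈) x<y λ j →
      proj₁ (cell⁻ (member j)) , proj₁ (proj₂ (cell⁻ (member j))))
    ... | no  xy≢pq = int (edge-between (vertex x x∈) (vertex y y∈) x<y λ j x<j j<y →
      xy≢pq (proj₂ (proj₂ (cell⁻ (member j))) x y (x<y , inj₂ d) (proj₁ (cell⁻ x∈)) x<j j<y
        (proj₁ (proj₂ (cell⁻ y∈)))))

    cell-part : IsPart D (cell p q)
    cell-part = record
      { polygon = cell-polygon
      ; edges   = λ { (diagonal i@(vertex _ _) k@(vertex _ _) i≢k) e →
        edges (member i) (member k) i≢k e }
      ; uncut   = λ { (diagonal i@(vertex _ _) k@(vertex _ _) i≢k) int →
        uncut (member i) (member k) i≢k int }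
      }
      where
      edges : ∀ {x y} (x∈ : x ∈ cell p q) (y∈ : y ∈ cell p q) .(x≢y : vertex x x∈ ≢ vertex y y∈) →
              let d = diagonal (vertex x x∈) (vertex y y∈) x≢y in Edge d → D (embed d) ⊎ Edge (embed d)
      edges {x} {y} x∈ y∈ x≢y e with Fin.<-cmp x y
      ... | tri< x<y _ _ = cell-edge x∈ y∈ x<y x≢y e
      ... | tri≈ _ x≡y _ = ⊥-elim (recompute-≢ x≢y (vertex-≡ x≡y))
      ... | tri> _ _ y<x with cell-edge y∈ x∈ y<x (x≢y ∘ ≡.sym) (swap e)
      ...   | inj₁ d  = inj₁ (reverse-closed _ d)
      ...   | inj₂ e′ = inj₂ (swap e′)
      uncut : ∀ {x y} (x∈ : x ∈ cell p q) (y∈ : y ∈ cell p q) .(x≢y : vertex x x∈ ≢ vertex y y∈) →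
              let d = diagonal (vertex x x∈) (vertex y y∈) x≢y in Internal d → ¬ D (embed d)
      uncut {x} {y} x∈ y∈ x≢y int d with Fin.<-cmp x y
      ... | tri< x<y _ _ = cell-uncut x∈ y∈ x<y x≢y int d
      ... | tri≈ _ x≡y _ = ⊥-elim (recompute-≢ x≢y (vertex-≡ x≡y))
      ... | tri> _ _ y<x = cell-uncut y∈ x∈ y<x (x≢y ∘ ≡.sym) (int ∘ swap) (reverse-closed _ d)

  module _ {Q : Subset n} (part : IsPart D Q) where

    open IsPart part

    -- The vertices of `Q` nearest to `x` on either side are neighbours in `Q`, so they form a
    -- diagonal of `D` or an edge of the polygon. With `x` between them, such an edge can only be
    -- the outer pair.
    part-gap : ∀ {p q x} → p ∈ Q → p < x → q ∈ Q → x < q → ¬ x ∈ Q →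
               ∃[ a ] ∃[ b ] a ∈ Q × b ∈ Q × a < x × x < b × Arc a b ×
                 (∀ {y} → y ∈ Q → y ≤ᶠ a ⊎ b ≤ᶠ y)
    part-gap {p} {q} {x} p∈Q p<x q∈Q x<q x∉Q
      with greatest (λ a → a ∈? Q ×-dec a Fin.<? x) (p , p∈Q , p<x)
         | least (λ b → b ∈? Q ×-dec x Fin.<? b) (q , q∈Q , x<q)
    ... | a , (a∈Q , a<x) , a-max | b , (b∈Q , x<b) , b-min =
      a , b , a∈Q , b∈Q , a<x , x<b , to-arc
        (edges (diagonal (vertex a a∈Q) (vertex b b∈Q) (<⇒≢ a<b)) a–b) , consecutive
      where
      a<b = ℕ.<-trans a<x x<b
      consecutive : ∀ {y} → y ∈ Q → y ≤ᶠ a ⊎ b ≤ᶠ y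
      consecutive {y} y∈Q with Fin.<-cmp y x
      ... | tri< y<x _ _ = inj₁ (a-max y (y∈Q , y<x))
      ... | tri≈ _ ≡.refl _ = ⊥-elim (x∉Q y∈Q)
      ... | tri> _ _ x<y = inj₂ (b-min y (y∈Q , x<y))
      a–b : Edge (diagonal (vertex a a∈Q) (vertex b b∈Q) (<⇒≢ a<b))
      a–b = edge-between (vertex a a∈Q) (vertex b b∈Q) a<b λ j a<j j<b →
        separated a<j j<b (consecutive (member j))
        where
        separated : ∀ {j : Fin n} → a < j → j < b → ¬ (j ≤ᶠ a ⊎ b ≤ᶠ j)
        separated a<j j<b (inj₁ j≤a) = ℕ.<⇒≱ a<j j≤a
        separated a<j j<b (inj₂ b≤j) = ℕ.<⇒≱ j<b b≤j
      to-arc : D (chord a<b) ⊎ Edge (chord a<b) → Arc a b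
      to-arc (inj₁ d) = a<b , inj₂ d
      to-arc (inj₂ e) with edge-cases ⟨ a ⟩ ⟨ b ⟩ a<b e
      ... | inj₁ between = ⊥-elim (between ⟨ x ⟩ a<x x<b)
      ... | inj₂ around  = a<b , inj₁ λ j → around ⟨ j ⟩

    -- The extreme vertices `p`, `q` of `Q` form an edge of `Q`, and hence an arc. Let an arc below
    -- it pass over a vertex of `Q`: if one of its ends is missing from `Q`, the arc over that gap
    -- crosses it; if both ends lie in `Q`, it is (p,q) or would cut `Q`. Conversely, a visible
    -- vertex missing from `Q` lies under a gap arc, which visibility forces to be (p,q), and then
    -- `Q` has no third vertex.
    part-cell : ∃[ p ] ∃[ q ] Arc p q × Q ≡ cell p q
    part-cell with third-element polygon (fromℕ< 3≤n) (fromℕ< 3≤n)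
    ... | x , x∈Q , _ with least (_∈? Q) (x , x∈Q) | greatest (_∈? Q) (x , x∈Q)
    ...   | p , p∈Q , p-min | q , q∈Q , q-max = p , q , pq , ⊆-antisym ⊆cell cell⊆
      where
      p<q : p < q
      p<q = let y , y∈Q , y≢p , _ = third-element polygon p p in
        ℕ.<-≤-trans (ℕ.≤∧≢⇒< (p-min y y∈Q) λ p≡y → y≢p (≡.sym (Fin.toℕ-injective p≡y)))
          (q-max y y∈Q)
      strictly-inside : ∀ {y} → y ∈ Q → y ≢ p → y ≢ q → p < y × y < q
      strictly-inside {y} y∈Q y≢p y≢q =
        ℕ.≤∧≢⇒< (p-min y y∈Q) (y≢p ∘ ≡.sym ∘ Fin.toℕ-injective) ,
          ℕ.≤∧≢⇒< (q-max y y∈Q) (y≢q ∘ Fin.toℕ-injective)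
      to-arc : D (chord p<q) ⊎ Edge (chord p<q) → Arc p q
      to-arc (inj₁ d) = p<q , inj₂ d
      to-arc (inj₂ e) with edge-cases ⟨ p ⟩ ⟨ q ⟩ p<q e
      ... | inj₂ around  = p<q , inj₁ λ j → around ⟨ j ⟩
      ... | inj₁ between = let y , y∈Q , y≢p , y≢q = third-element polygon p q
                               p<y , y<q = strictly-inside y∈Q y≢p y≢q in
        ⊥-elim (between ⟨ y ⟩ p<y y<q)
      pq : Arc p q
      pq = to-arc (edges (diagonal (vertex p p∈Q) (vertex q q∈Q) (<⇒≢ p<q))
        (edge-around (vertex p p∈Q) (vertex q q∈Q) p<q λ j → p-min _ (member j) ,
          q-max _ (member j)))
      uncut-at : ∀ {j} → j ∈ Q → ∀ t v → Arc t v → p ≤ᶠ t → t < j → j < v → v ≤ᶠ q → t ≡ p × v ≡ q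
      uncut-at {j} j∈Q t v tv p≤t t<j j<v v≤q with t ∈? Q | v ∈? Q
      ... | no t∉Q | _ =
        let a , b , _ , _ , a<t , t<b , ab , consecutive = part-gap p∈Q
              (ℕ.≤∧≢⇒< p≤t λ p≡t → t∉Q (≡.subst (_∈ Q) (Fin.toℕ-injective p≡t) p∈Q)) j∈Q t<j t∉Q
        in ⊥-elim (arcs-nest ab tv a<t t<b (ℕ.≤-<-trans (above-a a<t (consecutive j∈Q)) j<v))
        where
        above-a : ∀ {a b} → a < t → j ≤ᶠ a ⊎ b ≤ᶠ j → b ≤ᶠ j
        above-a a<t (inj₁ j≤a) = ⊥-elim (ℕ.<⇒≱ (ℕ.<-trans a<t t<j) j≤a)
        above-a a<t (inj₂ b≤j) = b≤j
      ... | yes _ | no v∉Q =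
        let a , b , _ , _ , a<v , v<b , ab , consecutive = part-gap j∈Q j<v q∈Q
              (ℕ.≤∧≢⇒< v≤q λ v≡q → v∉Q (≡.subst (_∈ Q) (≡.sym (Fin.toℕ-injective v≡q)) q∈Q)) v∉Q
        in ⊥-elim (arcs-nest tv ab (ℕ.<-≤-trans t<j (below-b v<b (consecutive j∈Q))) a<v v<b)
        where
        below-b : ∀ {a b} → v < b → j ≤ᶠ a ⊎ b ≤ᶠ j → j ≤ᶠ a
        below-b v<b (inj₁ j≤a) = j≤a
        below-b v<b (inj₂ b≤j) = ⊥-elim (ℕ.<⇒≱ (ℕ.<-trans j<v v<b) b≤j)
      ... | yes t∈Q | yes v∈Q with t Fin.≟ p ×-dec v Fin.≟ q | tv
      ...   | yes tv≡pq | _ = tv≡pq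
      ...   | no  _     | _ , inj₁ o =
        Fin.≤-antisym (proj₁ (o p)) p≤t , Fin.≤-antisym v≤q (proj₂ (o q))
      ...   | no  tv≢pq | t<v , inj₂ d = ⊥-elim (uncut
        (diagonal (vertex t t∈Q) (vertex v v∈Q) (<⇒≢ t<v)) internal-tv d)
        where
        internal-tv : ¬ Edge (diagonal (vertex t t∈Q) (vertex v v∈Q) (<⇒≢ t<v))
        internal-tv e with edge-cases (vertex t t∈Q) (vertex v v∈Q) t<v e
        ... | inj₁ between = between (vertex j j∈Q) t<j j<v
        ... | inj₂ around  = tv≢pq
          ( Fin.≤-antisym (proj₁ (around (vertex p p∈Q))) p≤t
          , Fin.≤-antisym v≤q (proj₂ (around (vertex q q∈Q))))
      ⊆cell : ∀ {j} → j ∈ Q → j ∈ cell p q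
      ⊆cell {j} j∈Q = cell⁺ (p-min j j∈Q , q-max j j∈Q , uncut-at j∈Q)
      cell⊆ : ∀ {j} → j ∈ cell p q → j ∈ Q
      cell⊆ {j} j∈cell with j ∈? Q | cell⁻ j∈cell
      ... | yes j∈Q | _ = j∈Q
      ... | no  j∉Q | p≤j , j≤q , j-vis =
        let a , b , a∈Q , b∈Q , a<j , j<b , ab , consecutive = part-gap p∈Q
              (ℕ.≤∧≢⇒< p≤j λ p≡j → j∉Q (≡.subst (_∈ Q) (Fin.toℕ-injective p≡j) p∈Q)) q∈Q
              (ℕ.≤∧≢⇒< j≤q λ j≡q → j∉Q (≡.subst (_∈ Q) (≡.sym (Fin.toℕ-injective j≡q)) q∈Q)) j∉Q
            a≡p , b≡q = j-vis a b ab (p-min a a∈Q) a<j j<b (q-max b b∈Q)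
            y , y∈Q , y≢p , y≢q = third-element polygon p q
            p<y , y<q = strictly-inside y∈Q y≢p y≢q
        in ⊥-elim (not-consecutive (≡.subst (_< y) (≡.sym a≡p) p<y)
          (≡.subst (y <_) (≡.sym b≡q) y<q) (consecutive y∈Q))
        where
        not-consecutive : ∀ {a b y : Fin n} → a < y → y < b → ¬ (y ≤ᶠ a ⊎ b ≤ᶠ y)
        not-consecutive a<y y<b (inj₁ y≤a) = ℕ.<⇒≱ a<y y≤a
        not-consecutive a<y y<b (inj₂ b≤y) = ℕ.<⇒≱ y<b b≤y

-- Nesting of the parts and the place of each vertex among them

module Parts {n : ℕ} (3≤n : 3 ℕ.≤ n) {D : Pred (Diagonal {n} ⊤) 0ℓ}
             (D? : ∀ d → Dec (D d)) (dissection : IsDissection D)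
             {m : ℕ} {P : Fin m → Subset n} (divides : DividesInto D P) where

  open Arcs 3≤n D? dissection
  open DividesInto divides using (parts; all)

  arcs-through : ∀ {p q p′ q′ i : Fin n} → Arc p q → Arc p′ q′ → p < i → i < q → p′ < i → i < q′ →
                 (p ≤ᶠ p′ × q′ ≤ᶠ q) ⊎ (p′ ≤ᶠ p × q ≤ᶠ q′)
  arcs-through {p} {q} {p′} {q′} pq p′q′ p<i i<q p′<i i<q′ with Fin.<-cmp p p′ | Fin.<-cmp q q′
  ... | tri< p<p′ _ _ | tri< q<q′ _ _ = ⊥-elim (arcs-nest pq p′q′ p<p′ (ℕ.<-trans p′<i i<q) q<q′)
  ... | tri< p<p′ _ _ | tri≈ _ ≡.refl _ = inj₁ (ℕ.<⇒≤ p<p′ , ℕ.≤-refl)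
  ... | tri< p<p′ _ _ | tri> _ _ q′<q = inj₁ (ℕ.<⇒≤ p<p′ , ℕ.<⇒≤ q′<q)
  ... | tri≈ _ ≡.refl _ | tri< q<q′ _ _ = inj₂ (ℕ.≤-refl , ℕ.<⇒≤ q<q′)
  ... | tri≈ _ ≡.refl _ | tri≈ _ ≡.refl _ = inj₁ (ℕ.≤-refl , ℕ.≤-refl)
  ... | tri≈ _ ≡.refl _ | tri> _ _ q′<q = inj₁ (ℕ.≤-refl , ℕ.<⇒≤ q′<q)
  ... | tri> _ _ p′<p | tri< q<q′ _ _ = inj₂ (ℕ.<⇒≤ p′<p , ℕ.<⇒≤ q<q′)
  ... | tri> _ _ p′<p | tri≈ _ ≡.refl _ = inj₂ (ℕ.<⇒≤ p′<p , ℕ.≤-refl)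
  ... | tri> _ _ p′<p | tri> _ _ q′<q = ⊥-elim (arcs-nest p′q′ pq p′<p (ℕ.<-trans p<i i<q′) q′<q)

  private
    0<n : 0 ℕ.< n
    0<n = ℕ.≤-trans (s≤s z≤n) 3≤n

  abstract

    first last : Fin n
    first = fromℕ< 0<n
    last  = proj₁ (greatest {P = λ _ → 0 ℕ.< n} (λ _ → 0 ℕ.<? n) (first , 0<n))

    first-least : ∀ (j : Fin n) → first ≤ᶠ j
    first-least j = ℕ.≤-trans (ℕ.≤-reflexive (Fin.toℕ-fromℕ< 0<n)) z≤n

    last-greatest : ∀ (j : Fin n) → j ≤ᶠ last
    last-greatest j = proj₂ (proj₂ (greatest {P = λ _ → 0 ℕ.< n} (λ _ → 0 ℕ.<? n) (first , 0<n))) j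
      0<n

  outer-arc : Arc first last
  outer-arc = ℕ.<-≤-trans first<2 (last-greatest (fromℕ< 3≤n)) , inj₁ λ j → first-least j ,
    last-greatest j
    where
    first<2 : first < fromℕ< 3≤n
    first<2 = ℕ.≤-<-trans (ℕ.≤-trans (first-least (fromℕ< 0<n))
      (ℕ.≤-reflexive (Fin.toℕ-fromℕ< 0<n)))
      (ℕ.≤-trans (s≤s z≤n) (ℕ.≤-reflexive (≡.sym (Fin.toℕ-fromℕ< 3≤n))))

  abstract

    lo hi : Fin m → Fin n
    lo α = proj₁ (part-cell (parts α))
    hi α = proj₁ (proj₂ (part-cell (parts α)))

    part-arc : ∀ α → Arc (lo α) (hi α)
    part-arc α = proj₁ (proj₂ (proj₂ (part-cell (parts α))))

    part≡cell : ∀ α → P α ≡ cell (lo α) (hi α)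
    part≡cell α = proj₂ (proj₂ (proj₂ (part-cell (parts α))))

  part⁻ : ∀ {α j} → j ∈ P α → Visible (lo α) (hi α) j
  part⁻ {α} j∈P = cell⁻ (≡.subst (_ ∈_) (part≡cell α) j∈P)

  part⁺ : ∀ {α j} → Visible (lo α) (hi α) j → j ∈ P α
  part⁺ {α} j-vis = ≡.subst (_ ∈_) (≡.sym (part≡cell α)) (cell⁺ j-vis)

  lo<hi : ∀ α → lo α < hi α
  lo<hi α = proj₁ (part-arc α)

  lo∈ : ∀ α → lo α ∈ P α
  lo∈ α = part⁺ (visible-src (ℕ.<⇒≤ (lo<hi α)))

  hi∈ : ∀ α → hi α ∈ P α
  hi∈ α = part⁺ (visible-tgt (ℕ.<⇒≤ (lo<hi α)))

  -- The arc of a cell is recovered from its least and greatest vertex, so the index supplied by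
  -- `all` has the right ends.
  part-of : ∀ {p q} → Arc p q → ∃[ α ] lo α ≡ p × hi α ≡ q
  part-of {p} {q} pq with all (cell p q) (cell-part pq)
  ... | α , Pα≡cell = α
    , Fin.≤-antisym (proj₁ (part⁻ (in-part (visible-src (ℕ.<⇒≤ (proj₁ pq))))))
      (proj₁ (cell⁻ (in-cell (lo∈ α))))
    , Fin.≤-antisym (proj₁ (proj₂ (cell⁻ (in-cell (hi∈ α)))))
      (proj₁ (proj₂ (part⁻ (in-part (visible-tgt (ℕ.<⇒≤ (proj₁ pq)))))))
    where
    in-part : ∀ {j} → Visible p q j → j ∈ P α
    in-part j-vis = ≡.subst (_ ∈_) (≡.sym Pα≡cell) (cell⁺ j-vis)
    in-cell : ∀ {j} → j ∈ P α → j ∈ cell p q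
    in-cell = ≡.subst (_ ∈_) Pα≡cell

  part-containing : ∀ {p q} → Arc p q → ∃[ α ] (∀ {j} → Visible p q j → j ∈ P α) × lo α ≡ p ×
    hi α ≡ q
  part-containing pq with part-of pq
  ... | α , ≡.refl , ≡.refl = α , part⁺ , ≡.refl , ≡.refl

  Inner : Fin m → Fin n → Set
  Inner α i = i ∈ P α × lo α < i × i < hi α

  inner? : ∀ α i → Dec (Inner α i)
  inner? α i = i ∈? P α ×-dec lo α Fin.<? i ×-dec i Fin.<? hi α

  part-unique : ∀ {α β} → lo α ≡ lo β → hi α ≡ hi β → α ≡ β
  part-unique {α} {β} lo≡ hi≡ = DividesInto.distinct divides
    (≡.trans (part≡cell α) (≡.trans (≡.cong₂ cell lo≡ hi≡) (≡.sym (part≡cell β))))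

  -- Both arcs pass over `i` and are nested; as `i` is visible below the wider one, the two
  -- coincide.
  inner-unique : ∀ {α β i} → Inner α i → Inner β i → α ≡ β
  inner-unique {α} {β} {i} (i∈α , loα<i , i<hiα) (i∈β , loβ<i , i<hiβ)
    with arcs-through (part-arc α) (part-arc β) loα<i i<hiα loβ<i i<hiβ
  ... | inj₁ (lo≤ , ≤hi) =
    let p , q = proj₂ (proj₂ (part⁻ i∈α)) _ _ (part-arc β) lo≤ loβ<i i<hiβ ≤hi in part-unique (≡.sym p) (≡.sym q)
  ... | inj₂ (lo≤ , ≤hi) =
    let p , q = proj₂ (proj₂ (part⁻ i∈β)) _ _ (part-arc α) lo≤ loα<i i<hiα ≤hi in part-unique p q

  data Position (i : Fin n) : Set where
    is-first : i ≡ first → Position i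
    is-last  : i ≡ last → Position i
    is-inner : ∀ α → Inner α i → Position i

  -- Below the narrowest arc passing strictly over `i`, nothing else can hide `i`. The outer arc
  -- shows that there is a candidate.
  position : ∀ i → Position i
  position i with i Fin.≟ first | i Fin.≟ last
  ... | yes i≡first | _          = is-first i≡first
  ... | no  _       | yes i≡last = is-last i≡last
  ... | no  i≢first | no  i≢last
    with narrowest (λ p q → arc? p q ×-dec p Fin.<? i ×-dec i Fin.<? q)
      (outer-arc , first<i , i<last)
    where
    first<i : first < i
    first<i = ℕ.≤∧≢⇒< (first-least i) (i≢first ∘ ≡.sym ∘ Fin.toℕ-injective)
    i<last : i < last
    i<last = ℕ.≤∧≢⇒< (last-greatest i) (i≢last ∘ Fin.toℕ-injective)
  ...   | p , q , (pq , p<i , i<q) , narrow with part-containing pq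
  ...     | α , ∈α , ≡.refl , ≡.refl = is-inner α (∈α i-vis , p<i , i<q)
    where
    i-vis : Visible p q i
    i-vis = ℕ.<⇒≤ p<i , ℕ.<⇒≤ i<q , λ t v tv p≤t t<i i<v v≤q →
      span-≤⇒≡ p≤t (proj₁ tv) v≤q (narrow t v (tv , t<i , i<v))

  inner≢first : ∀ {α} → ¬ Inner α first
  inner≢first (_ , lo<first , _) = ℕ.<⇒≱ lo<first (first-least _)

  inner≢last : ∀ {α} → ¬ Inner α last
  inner≢last (_ , _ , last<hi) = ℕ.<⇒≱ last<hi (last-greatest _)

  width : Fin m → ℕ
  width α = span (lo α) (hi α)

  width≤n : ∀ α → width α ℕ.≤ n
  width≤n α = ℕ.≤-trans (ℕ.m∸n≤m (toℕ (hi α)) (toℕ (lo α))) (ℕ.<⇒≤ (Fin.toℕ<n (hi α)))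

  infix 4 _≺_

  -- The dependency relation of the recursion for `column` and `row`.
  _≺_ : Fin n → Fin n → Set
  j ≺ i = ∃[ α ] Inner α i × (j ≡ lo α ⊎ j ≡ hi α)

  width-lo : ∀ {α β} → Inner β (lo α) → width α ℕ.< width β
  width-lo {α} {β} (_ , loβ<lo , lo<hiβ) = span-< (ℕ.<⇒≤ loβ<lo) (lo<hi α)
    (ℕ.≮⇒≥ λ hiβ<hi → arcs-nest (part-arc β) (part-arc α) loβ<lo lo<hiβ hiβ<hi)
    (λ (lo≡ , _) → Fin.<⇒≢ loβ<lo (≡.sym lo≡))

  width-hi : ∀ {α β} → Inner β (hi α) → width α ℕ.< width β
  width-hi {α} {β} (_ , loβ<hi , hi<hiβ) = span-<
    (ℕ.≮⇒≥ λ lo<loβ → arcs-nest (part-arc α) (part-arc β) lo<loβ loβ<hi hi<hiβ) (lo<hi α)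
    (ℕ.<⇒≤ hi<hiβ) (λ (_ , hi≡) → Fin.<⇒≢ hi<hiβ hi≡)

  -- If an end of the arc of α is strictly inside another cell, the arc of that cell is strictly
  -- wider. Widths are at most n, so n ∸ width decreases.
  ≺-wellFounded : ∀ i → Acc _≺_ i
  ≺-wellFounded i with position i
  ... | is-first ≡.refl  = acc λ (_ , inner , _) → ⊥-elim (inner≢first inner)
  ... | is-last ≡.refl   = acc λ (_ , inner , _) → ⊥-elim (inner≢last inner)
  ... | is-inner α inner = acc-inner α inner (<-wellFounded (n ∸ width α))
    where
    acc-inner : ∀ α {i} → Inner α i → Acc ℕ._<_ (n ∸ width α) → Acc _≺_ i
    acc-inner α inner (acc rs) = acc smaller
      where
      smaller : ∀ {j} → j ≺ _ → Acc _≺_ j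
      smaller {j} (β , inner′ , j≡) with inner-unique inner inner′ | position j
      ... | _ | is-first ≡.refl = acc λ (_ , inner , _) → ⊥-elim (inner≢first inner)
      ... | _ | is-last ≡.refl  = acc λ (_ , inner , _) → ⊥-elim (inner≢last inner)
      ... | ≡.refl | is-inner γ inner″ = acc-inner γ inner″
        (rs (ℕ.∸-monoʳ-< (wider j≡ inner″) (width≤n γ)))
        where
        wider : ∀ {j} → j ≡ lo α ⊎ j ≡ hi α → Inner γ j → width α ℕ.< width γ
        wider (inj₁ ≡.refl) = width-lo
        wider (inj₂ ≡.refl) = width-hi

  -- β is the part on the other side of the diagonal closing α. Its arc is the narrowest one over
  -- that diagonal, the diagonal itself excepted, and therefore leaves both ends visible.
  above : ∀ α → (lo α ≡ first × hi α ≡ last) ⊎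
                (D (chord (lo<hi α)) × ∃[ β ] lo α ∈ P β × hi α ∈ P β × width α ℕ.< width β)
  above α with part-arc α
  ... | lo<hi , inj₁ outer =
    inj₁ (Fin.≤-antisym (proj₁ (outer first)) (first-least _) ,
      Fin.≤-antisym (last-greatest _) (proj₂ (outer last)))
  ... | lo<hi , inj₂ d
    with narrowest (λ p q → arc? p q ×-dec p Fin.≤? lo α ×-dec hi α Fin.≤? q ×-dec ¬?
      (lo α Fin.≟ p ×-dec hi α Fin.≟ q))
           (outer-arc , first-least _ , last-greatest _ , not-outer)
    where
    not-outer : ¬ (lo α ≡ first × hi α ≡ last)
    not-outer (lo≡ , hi≡) = chord-inner lo<hi d λ j →
      ≡.subst (_≤ᶠ j) (≡.sym lo≡) (first-least j) , ≡.subst (j ≤ᶠ_) (≡.sym hi≡) (last-greatest j)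
  ...   | p , q , (pq , p≤lo , hi≤q , ≢pq) , narrow with part-containing pq
  ...     | β , ∈β , ≡.refl , ≡.refl =
    inj₂ (d , β , ∈β lo-vis , ∈β hi-vis , span-< p≤lo lo<hi hi≤q ≢pq)
    where
    arc-α : Arc (lo α) (hi α)
    arc-α = lo<hi , inj₂ d
    lo-vis : Visible p q (lo α)
    lo-vis = p≤lo , ℕ.≤-trans (ℕ.<⇒≤ lo<hi) hi≤q , λ t v tv p≤t t<lo lo<v v≤q →
      span-≤⇒≡ p≤t (proj₁ tv) v≤q (narrow t v (tv , ℕ.<⇒≤ t<lo
        , ℕ.≮⇒≥ (arcs-nest tv arc-α t<lo lo<v) , λ (lo≡t , _) → Fin.<⇒≢ t<lo (≡.sym lo≡t)))
    hi-vis : Visible p q (hi α)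
    hi-vis = ℕ.≤-trans p≤lo (ℕ.<⇒≤ lo<hi) , hi≤q , λ t v tv p≤t t<hi hi<v v≤q →
      span-≤⇒≡ p≤t (proj₁ tv) v≤q (narrow t v (tv
        , ℕ.≮⇒≥ (λ lo<t → arcs-nest arc-α tv lo<t t<hi hi<v) , ℕ.<⇒≤ hi<v , λ (_ , hi≡v) →
          Fin.<⇒≢ hi<v hi≡v))

  Together : Fin n → Fin n → Set
  Together u w = ∃[ α ] u ∈ P α × w ∈ P α

  Separated : Fin n → Fin n → Set
  Separated u w = ∃[ α ] Inner α u × D (chord (lo<hi α)) × (w < lo α ⊎ hi α < w)

  inner-chord : ∀ α {w} → w < lo α ⊎ hi α < w → D (chord (lo<hi α))
  inner-chord α w-out with part-arc α
  ... | lo<hi , inj₂ d = d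
  inner-chord α {w} (inj₁ w<lo) | lo<hi , inj₁ outer = ⊥-elim (ℕ.<⇒≱ w<lo (proj₁ (outer w)))
  inner-chord α {w} (inj₂ hi<w) | lo<hi , inj₁ outer = ⊥-elim (ℕ.<⇒≱ hi<w (proj₂ (outer w)))

  -- Take the narrowest arc over both. Another arc below it that hides `u` must end before `w`. But
  -- it is nested with the arc of the cell having `u` strictly inside, and so ends no earlier than
  -- that arc, which by hypothesis reaches `w`. The argument for `w` is symmetric.
  together : ∀ {u w} → u < w → (∀ α → Inner α u → w ≤ᶠ hi α) → (∀ α → Inner α w → lo α ≤ᶠ u) →
    Together u w
  together {u} {w} u<w above-u below-w
    with narrowest (λ p q → arc? p q ×-dec p Fin.≤? u ×-dec w Fin.≤? q)
      (outer-arc , first-least u , last-greatest w)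
  ... | p , q , (pq , p≤u , w≤q) , narrow with part-containing pq
  ...   | α , ∈α , _ = α , ∈α u-vis , ∈α w-vis
    where
    u-vis : Visible p q u
    u-vis = p≤u , ℕ.≤-trans (ℕ.<⇒≤ u<w) w≤q , λ t v tv p≤t t<u u<v v≤q →
      span-≤⇒≡ p≤t (proj₁ tv) v≤q (narrow t v (tv , ℕ.<⇒≤ t<u , ℕ.≮⇒≥ (cut tv t<u u<v)))
      where
      cut : ∀ {t v} → Arc t v → t < u → u < v → ¬ v < w
      cut {t} {v} tv t<u u<v v<w with position u
      ... | is-first ≡.refl = ℕ.<⇒≱ t<u (first-least t)
      ... | is-last ≡.refl  = ℕ.<⇒≱ u<w (last-greatest w)
      ... | is-inner β inner@(u∈β , lo<u , u<hi) with arcs-through (part-arc β) tv lo<u u<hi t<u u<v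
      ...   | inj₁ (lo≤t , v≤hi) = ℕ.<⇒≱ (ℕ.<-≤-trans v<w (above-u β inner))
                (ℕ.≤-reflexive (≡.cong toℕ (≡.sym (proj₂
                  (proj₂ (proj₂ (part⁻ u∈β)) t v tv lo≤t t<u u<v v≤hi)))))
      ...   | inj₂ (_ , hi≤v)    = ℕ.<⇒≱ (ℕ.<-≤-trans v<w (above-u β inner)) hi≤v
    w-vis : Visible p q w
    w-vis = ℕ.≤-trans p≤u (ℕ.<⇒≤ u<w) , w≤q , λ t v tv p≤t t<w w<v v≤q →
      span-≤⇒≡ p≤t (proj₁ tv) v≤q (narrow t v (tv , ℕ.≮⇒≥ (cut tv t<w w<v) , ℕ.<⇒≤ w<v))
      where
      cut : ∀ {t v} → Arc t v → t < w → w < v → ¬ u < t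
      cut {t} {v} tv t<w w<v u<t with position w
      ... | is-first ≡.refl = ℕ.<⇒≱ u<w (first-least u)
      ... | is-last ≡.refl  = ℕ.<⇒≱ w<v (last-greatest v)
      ... | is-inner β inner@(w∈β , lo<w , w<hi) with arcs-through (part-arc β) tv lo<w w<hi t<w w<v
      ...   | inj₁ (lo≤t , v≤hi) = ℕ.<⇒≱ (ℕ.≤-<-trans (below-w β inner) u<t)
                (ℕ.≤-reflexive (≡.cong toℕ (proj₁ (proj₂ (proj₂ (part⁻ w∈β)) t v tv lo≤t t<w w<v
                  v≤hi))))
      ...   | inj₂ (t≤lo , _)    = ℕ.<⇒≱ (ℕ.≤-<-trans (below-w β inner) u<t) t≤lo

  together-or-separated : ∀ {u w} → u < w → Together u w ⊎ Separated u w ⊎ Separated w u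
  together-or-separated {u} {w} u<w
    with Fin.any? (λ α → inner? α u ×-dec hi α Fin.<? w) | Fin.any?
      (λ α → inner? α w ×-dec u Fin.<? lo α)
  ... | yes (α , inner , hi<w) | _ = inj₂ (inj₁ (α , inner , inner-chord α (inj₂ hi<w) , inj₂ hi<w))
  ... | no _ | yes (α , inner , u<lo) =
    inj₂ (inj₂ (α , inner , inner-chord α (inj₁ u<lo) , inj₁ u<lo))
  ... | no none-u | no none-w = inj₁ (together u<w
    (λ α inner → ℕ.≮⇒≥ λ hi<w → none-u (α , inner , hi<w))
    (λ α inner → ℕ.≮⇒≥ λ u<lo → none-w (α , inner , u<lo)))

-- Existence and uniqueness of the gluing

module Gluing {a ℓ} (R : Ring a ℓ) {n : ℕ} (3≤n : 3 ℕ.≤ n) {D : Pred (Diagonal {n} ⊤) 0ℓ}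
              (D? : ∀ d → Dec (D d)) (dissection : IsDissection D)
              {m : ℕ} {P : Fin m → Subset n} (divides : DividesInto D P)
              (M : ∀ α → Vertex (P α) → Vertex (P α) → Ring.Carrier R)
              (M-diag : ∀ α i → Ring._≈_ R (M α i i) (Ring.0# R))
              (pivot : ∀ α {i j} → i ≢ j → SignedMatrices.Pivot R (M α) i j) where

  open Ring R
  open SignedMatrices R
  open IsDissection dissection using (reverse-closed)
  open Arcs 3≤n D? dissection
  open Parts 3≤n D? dissection divides
  open import Relation.Binary.Reasoning.Setoid setoid

  Vector : Set a
  Vector = Carrier × Carrier

  infix 7 _⊙_

  _⊙_ : Vector → Vector → Carrier
  (y₁ , y₂) ⊙ (x₁ , x₂) = y₁ * x₁ + y₂ * x₂

  -- Over a noncommutative ring columns are combined with scalars on the right and rows with scalars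
  -- on the left; this keeps `_⊙_` linear in each argument.
  columns : Vector → Carrier → Vector → Carrier → Vector
  columns (x₁ , x₂) k (z₁ , z₂) l = x₁ * k + z₁ * l , x₂ * k + z₂ * l

  rows : Carrier → Vector → Carrier → Vector → Vector
  rows k (x₁ , x₂) l (z₁ , z₂) = k * x₁ + l * z₁ , k * x₂ + l * z₂

  open CommutativeSemigroupProperties (CommutativeMonoid.commutativeSemigroup +-commutativeMonoid)
    using (interchange)

  ⊙-columns : ∀ y x k z l → y ⊙ columns x k z l ≈ (y ⊙ x) * k + (y ⊙ z) * l
  ⊙-columns (y₁ , y₂) (x₁ , x₂) k (z₁ , z₂) l = begin
    y₁ * (x₁ * k + z₁ * l) + y₂ * (x₂ * k + z₂ * l)
      ≈⟨ +-cong (distribˡ _ _ _) (distribˡ _ _ _) ⟩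
    (y₁ * (x₁ * k) + y₁ * (z₁ * l)) + (y₂ * (x₂ * k) + y₂ * (z₂ * l))
      ≈⟨ interchange _ _ _ _ ⟩
    (y₁ * (x₁ * k) + y₂ * (x₂ * k)) + (y₁ * (z₁ * l) + y₂ * (z₂ * l))
      ≈⟨ +-cong (+-cong (*-assoc _ _ _) (*-assoc _ _ _)) (+-cong (*-assoc _ _ _) (*-assoc _ _ _)) ⟨
    (y₁ * x₁ * k + y₂ * x₂ * k) + (y₁ * z₁ * l + y₂ * z₂ * l)
      ≈⟨ +-cong (distribʳ _ _ _) (distribʳ _ _ _) ⟨
    (y₁ * x₁ + y₂ * x₂) * k + (y₁ * z₁ + y₂ * z₂) * l ∎

  rows-⊙ : ∀ k x l z y → rows k x l z ⊙ y ≈ k * (x ⊙ y) + l * (z ⊙ y)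
  rows-⊙ k (x₁ , x₂) l (z₁ , z₂) (y₁ , y₂) = begin
    (k * x₁ + l * z₁) * y₁ + (k * x₂ + l * z₂) * y₂
      ≈⟨ +-cong (distribʳ _ _ _) (distribʳ _ _ _) ⟩
    (k * x₁ * y₁ + l * z₁ * y₁) + (k * x₂ * y₂ + l * z₂ * y₂)
      ≈⟨ interchange _ _ _ _ ⟩
    (k * x₁ * y₁ + k * x₂ * y₂) + (l * z₁ * y₁ + l * z₂ * y₂)
      ≈⟨ +-cong (+-cong (*-assoc _ _ _) (*-assoc _ _ _)) (+-cong (*-assoc _ _ _) (*-assoc _ _ _)) ⟩
    (k * (x₁ * y₁) + k * (x₂ * y₂)) + (l * (z₁ * y₁) + l * (z₂ * y₂))
      ≈⟨ +-cong (distribˡ _ _ _) (distribˡ _ _ _) ⟨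
    k * (x₁ * y₁ + x₂ * y₂) + l * (z₁ * y₁ + z₂ * y₂) ∎

  loᵛ hiᵛ : ∀ α → Vertex (P α)
  loᵛ α = vertex (lo α) (lo∈ α)
  hiᵛ α = vertex (hi α) (hi∈ α)

  loᵛ≢hiᵛ : ∀ α → loᵛ α ≢ hiᵛ α
  loᵛ≢hiᵛ α = <⇒≢ (lo<hi α)

  M-unit : ∀ α {i j} → i ≢ j → IsUnit R (M α i j)
  M-unit α i≢j = Pivot.unit (pivot α i≢j)

  M-pivot : ∀ α → Pivot (M α) (loᵛ α) (hiᵛ α)
  M-pivot α = pivot α (loᵛ≢hiᵛ α)

  hi-lo⁻¹ lo-hi⁻¹ : Fin m → Carrier
  hi-lo⁻¹ α = inv R (Pivot.unitʳ (M-pivot α))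
  lo-hi⁻¹ α = inv R (Pivot.unit (M-pivot α))

  -- The expansion of `M α u w` at (lo,hi) read in two ways: as M(u,lo) `colA` w + M(u,hi) `colB` w,
  -- and as `rowA` u M(hi,w) + `rowB` u M(lo,w).
  colA colB rowA rowB : ∀ α → Vertex (P α) → Carrier
  colA α w = hi-lo⁻¹ α * M α (hiᵛ α) w
  colB α w = lo-hi⁻¹ α * M α (loᵛ α) w
  rowA α u = M α u (loᵛ α) * hi-lo⁻¹ α
  rowB α u = M α u (hiᵛ α) * lo-hi⁻¹ α

  root : Fin m
  root = proj₁ (part-of outer-arc)

  lo-root : lo root ≡ first
  lo-root = proj₁ (proj₂ (part-of outer-arc))

  hi-root : hi root ≡ last
  hi-root = proj₂ (proj₂ (part-of outer-arc))

  column : ∀ i → Acc _≺_ i → Vector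
  column i (acc rs) with position i
  ... | is-first _ = 1# , 0#
  ... | is-last  _ = 0# , 1#
  ... | is-inner α inner = columns
    (column (lo α) (rs (α , inner , inj₁ ≡.refl))) (colA α (vertex i (proj₁ inner)))
    (column (hi α) (rs (α , inner , inj₂ ≡.refl))) (colB α (vertex i (proj₁ inner)))

  -- As the columns at `first` and `last` are the standard basis, the row of `u` has to consist of
  -- the values at (u,first) and (u,last). This dictates the two base rows.
  row : ∀ i → Acc _≺_ i → Vector
  row i (acc rs) with position i
  ... | is-first _ = 0# , M root (loᵛ root) (hiᵛ root)
  ... | is-last  _ = M root (hiᵛ root) (loᵛ root) , 0#
  ... | is-inner α inner = rows
    (rowA α (vertex i (proj₁ inner))) (row (hi α) (rs (α , inner , inj₂ ≡.refl)))
    (rowB α (vertex i (proj₁ inner))) (row (lo α) (rs (α , inner , inj₁ ≡.refl)))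

  -- Unfolding the recursion hands down accessibility proofs that need not be the ones chosen in the
  -- definition of `X`.
  column-irrelevant : ∀ i (p q : Acc _≺_ i) → column i p ≡ column i q
  column-irrelevant i (acc rs) (acc rs′) with position i
  ... | is-first _ = ≡.refl
  ... | is-last  _ = ≡.refl
  ... | is-inner α inner = ≡.cong₂ (λ x z → columns x _ z _)
    (column-irrelevant (lo α) (rs (α , inner , inj₁ ≡.refl)) (rs′ (α , inner , inj₁ ≡.refl)))
    (column-irrelevant (hi α) (rs (α , inner , inj₂ ≡.refl)) (rs′ (α , inner , inj₂ ≡.refl)))

  row-irrelevant : ∀ i (p q : Acc _≺_ i) → row i p ≡ row i q
  row-irrelevant i (acc rs) (acc rs′) with position i
  ... | is-first _ = ≡.refl
  ... | is-last  _ = ≡.refl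
  ... | is-inner α inner = ≡.cong₂ (λ x z → rows _ x _ z)
    (row-irrelevant (hi α) (rs (α , inner , inj₂ ≡.refl)) (rs′ (α , inner , inj₂ ≡.refl)))
    (row-irrelevant (lo α) (rs (α , inner , inj₁ ≡.refl)) (rs′ (α , inner , inj₁ ≡.refl)))

  first≢last : first ≢ last
  first≢last = Fin.<⇒≢ (proj₁ outer-arc)

  abstract

    X Y : Fin n → Vector
    X i = column i (≺-wellFounded i)
    Y i = row i (≺-wellFounded i)

    X-first : X first ≡ (1# , 0#)
    X-first with ≺-wellFounded first
    ... | acc _ with position first
    ...   | is-first _ = ≡.refl
    ...   | is-last e  = ⊥-elim (first≢last e)
    ...   | is-inner _ inner = ⊥-elim (inner≢first inner)

    X-last : X last ≡ (0# , 1#)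
    X-last with ≺-wellFounded last
    ... | acc _ with position last
    ...   | is-first e = ⊥-elim (first≢last (≡.sym e))
    ...   | is-last _  = ≡.refl
    ...   | is-inner _ inner = ⊥-elim (inner≢last inner)

    Y-first : Y first ≡ (0# , M root (loᵛ root) (hiᵛ root))
    Y-first with ≺-wellFounded first
    ... | acc _ with position first
    ...   | is-first _ = ≡.refl
    ...   | is-last e  = ⊥-elim (first≢last e)
    ...   | is-inner _ inner = ⊥-elim (inner≢first inner)

    Y-last : Y last ≡ (M root (hiᵛ root) (loᵛ root) , 0#)
    Y-last with ≺-wellFounded last
    ... | acc _ with position last
    ...   | is-first e = ⊥-elim (first≢last (≡.sym e))
    ...   | is-last _  = ≡.refl
    ...   | is-inner _ inner = ⊥-elim (inner≢last inner)

    X-inner : ∀ α {i} (inner : Inner α i) → let iᵛ = vertex i (proj₁ inner) in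
              X i ≡ columns (X (lo α)) (colA α iᵛ) (X (hi α)) (colB α iᵛ)
    X-inner α {i} inner with ≺-wellFounded i
    ... | acc rs with position i
    ...   | is-first ≡.refl = ⊥-elim (inner≢first inner)
    ...   | is-last ≡.refl  = ⊥-elim (inner≢last inner)
    ...   | is-inner β inner′ with inner-unique inner inner′
    ...     | ≡.refl = ≡.cong₂ (λ x z → columns x _ z _)
      (column-irrelevant (lo α) (rs (α , inner′ , inj₁ ≡.refl)) (≺-wellFounded (lo α)))
      (column-irrelevant (hi α) (rs (α , inner′ , inj₂ ≡.refl)) (≺-wellFounded (hi α)))

    Y-inner : ∀ α {i} (inner : Inner α i) → let iᵛ = vertex i (proj₁ inner) in
              Y i ≡ rows (rowA α iᵛ) (Y (hi α)) (rowB α iᵛ) (Y (lo α))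
    Y-inner α {i} inner with ≺-wellFounded i
    ... | acc rs with position i
    ...   | is-first ≡.refl = ⊥-elim (inner≢first inner)
    ...   | is-last ≡.refl  = ⊥-elim (inner≢last inner)
    ...   | is-inner β inner′ with inner-unique inner inner′
    ...     | ≡.refl = ≡.cong₂ (λ x z → rows _ x _ z)
      (row-irrelevant (hi α) (rs (α , inner′ , inj₂ ≡.refl)) (≺-wellFounded (hi α)))
      (row-irrelevant (lo α) (rs (α , inner′ , inj₁ ≡.refl)) (≺-wellFounded (lo α)))

  pairing : Fin n → Fin n → Carrier
  pairing u w = Y u ⊙ X w

  data InPart (α : Fin m) (i : Fin n) : Set where
    at-lo : i ≡ lo α → InPart α i
    at-hi : i ≡ hi α → InPart α i
    inner : Inner α i → InPart α i

  in-part : ∀ {α i} → i ∈ P α → InPart α i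
  in-part {α} {i} i∈ with i Fin.≟ lo α | i Fin.≟ hi α
  ... | yes i≡lo | _ = at-lo i≡lo
  ... | no  _ | yes i≡hi = at-hi i≡hi
  ... | no  i≢lo | no i≢hi = let lo≤i , i≤hi , _ = part⁻ i∈ in inner
    (i∈ , ℕ.≤∧≢⇒< lo≤i (i≢lo ∘ ≡.sym ∘ Fin.toℕ-injective) , ℕ.≤∧≢⇒< i≤hi (i≢hi ∘ Fin.toℕ-injective))

  -- For inner vertices this is the recursion defining `X`. It extends to the ends of the arc, where
  -- one coefficient is 1 and the other 0 because `M α` vanishes on the diagonal.
  column-expand : ∀ α {i} (i∈ : i ∈ P α) u →
                  pairing u i ≈ pairing u (lo α) * colA α (vertex i i∈) +
                    pairing u (hi α) * colB α (vertex i i∈)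
  column-expand α i∈ u with in-part {α} i∈
  ... | at-lo ≡.refl = sym (trans (+-cong
    (trans (*-congˡ (proj₁ (proj₂ (Pivot.unitʳ (M-pivot α))))) (*-identityʳ _))
    (trans (*-congˡ (trans (*-congˡ (M-diag α (loᵛ α))) (zeroʳ _))) (zeroʳ _))) (+-identityʳ _))
  ... | at-hi ≡.refl = sym (trans (+-cong
    (trans (*-congˡ (trans (*-congˡ (M-diag α (hiᵛ α))) (zeroʳ _))) (zeroʳ _))
    (trans (*-congˡ (proj₁ (proj₂ (Pivot.unit (M-pivot α))))) (*-identityʳ _))) (+-identityˡ _))
  ... | inner in-α = trans (reflexive (≡.cong (Y u ⊙_) (X-inner α in-α))) (⊙-columns (Y u) _ _ _ _)

  row-expand : ∀ α {i} (i∈ : i ∈ P α) w →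
               pairing i w ≈ rowA α (vertex i i∈) * pairing (hi α) w +
                 rowB α (vertex i i∈) * pairing (lo α) w
  row-expand α i∈ w with in-part {α} i∈
  ... | at-lo ≡.refl = sym (trans (+-cong
    (0xy≈0 (M-diag α (loᵛ α)) _ _)
    (cancelˡ (Pivot.unit (M-pivot α)) _)) (+-identityˡ _))
  ... | at-hi ≡.refl = sym (trans (+-cong
    (cancelˡ (Pivot.unitʳ (M-pivot α)) _)
    (0xy≈0 (M-diag α (hiᵛ α)) _ _)) (+-identityʳ _))
  ... | inner in-α = trans (reflexive (≡.cong (_⊙ X w) (Y-inner α in-α))) (rows-⊙ _ _ _ _ (X w))

  Realises : Fin m → Set ℓ
  Realises α = ∀ {i j} (i∈ : i ∈ P α) (j∈ : j ∈ P α) → pairing i j ≈ M α (vertex i i∈) (vertex j j∈)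

  -- On one part, `pairing` and `M α` expand with the same coefficients, so the four values at the
  -- ends of the arc determine all others.
  realises-from-base : ∀ α →
    pairing (lo α) (lo α) ≈ 0# → pairing (hi α) (hi α) ≈ 0# →
    pairing (lo α) (hi α) ≈ M α (loᵛ α) (hiᵛ α) → pairing (hi α) (lo α) ≈ M α (hiᵛ α) (loᵛ α) →
    Realises α
  realises-from-base α ll hh lh hl {i} {j} i∈ j∈ = begin
    pairing i j
      ≈⟨ row-expand α i∈ j ⟩
    rowA α iᵛ * pairing (hi α) j + rowB α iᵛ * pairing (lo α) j
      ≈⟨ +-cong (*-congˡ hi-row) (*-congˡ lo-row) ⟩
    rowA α iᵛ * M α (hiᵛ α) jᵛ + rowB α iᵛ * M α (loᵛ α) jᵛ
      ≈⟨ Pivot.expand (M-pivot α) iᵛ jᵛ ⟨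
    M α iᵛ jᵛ ∎
    where
    iᵛ = vertex i i∈
    jᵛ = vertex j j∈
    hi-row : pairing (hi α) j ≈ M α (hiᵛ α) jᵛ
    hi-row = begin
      pairing (hi α) j
        ≈⟨ column-expand α j∈ (hi α) ⟩
      pairing (hi α) (lo α) * colA α jᵛ + pairing (hi α) (hi α) * colB α jᵛ
        ≈⟨ +-cong (trans (*-congʳ hl) (sym (*-assoc _ _ _))) (trans (*-congʳ hh) (zeroˡ _)) ⟩
      M α (hiᵛ α) (loᵛ α) * hi-lo⁻¹ α * M α (hiᵛ α) jᵛ + 0#
        ≈⟨ trans (+-identityʳ _) (cancelˡ (Pivot.unitʳ (M-pivot α)) _) ⟩
      M α (hiᵛ α) jᵛ ∎
    lo-row : pairing (lo α) j ≈ M α (loᵛ α) jᵛ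
    lo-row = begin
      pairing (lo α) j
        ≈⟨ column-expand α j∈ (lo α) ⟩
      pairing (lo α) (lo α) * colA α jᵛ + pairing (lo α) (hi α) * colB α jᵛ
        ≈⟨ +-cong (trans (*-congʳ ll) (zeroˡ _)) (trans (*-congʳ lh) (sym (*-assoc _ _ _))) ⟩
      0# + M α (loᵛ α) (hiᵛ α) * lo-hi⁻¹ α * M α (loᵛ α) jᵛ
        ≈⟨ trans (+-identityˡ _) (cancelˡ (Pivot.unit (M-pivot α)) _) ⟩
      M α (loᵛ α) jᵛ ∎

  pairing-first-first : pairing first first ≈ 0#
  pairing-first-first rewrite X-first | Y-first = trans (+-cong (zeroˡ _) (zeroʳ _)) (+-identityˡ _)

  pairing-last-last : pairing last last ≈ 0#
  pairing-last-last rewrite X-last | Y-last = trans (+-cong (zeroʳ _) (zeroˡ _)) (+-identityˡ _)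

  pairing-first-last : pairing first last ≈ M root (loᵛ root) (hiᵛ root)
  pairing-first-last rewrite X-last | Y-first =
    trans (+-cong (zeroˡ _) (*-identityʳ _)) (+-identityˡ _)

  pairing-last-first : pairing last first ≈ M root (hiᵛ root) (loᵛ root)
  pairing-last-first rewrite X-first | Y-last =
    trans (+-cong (*-identityʳ _) (zeroˡ _)) (+-identityʳ _)

  root-realises : Realises root
  root-realises = realises-from-base root
    (trans (reflexive (≡.cong₂ pairing lo-root lo-root)) pairing-first-first)
    (trans (reflexive (≡.cong₂ pairing hi-root hi-root)) pairing-last-last)
    (trans (reflexive (≡.cong₂ pairing lo-root hi-root)) pairing-first-last)
    (trans (reflexive (≡.cong₂ pairing hi-root lo-root)) pairing-last-first)

  vertex-≢ : ∀ {α i j} (i∈ : i ∈ P α) (j∈ : j ∈ P α) → i ≢ j → vertex i i∈ ≢ vertex j j∈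
  vertex-≢ _ _ i≢j e = i≢j (≡.cong label e)

  realises-unit : ∀ {α} → Realises α → ∀ {i j} → i ∈ P α → j ∈ P α → i ≢ j → IsUnit R (pairing i j)
  realises-unit {α} realises i∈ j∈ i≢j =
    unit-cong (sym (realises i∈ j∈)) (M-unit α (vertex-≢ i∈ j∈ i≢j))

  -- The coordinates of Y u are m(u,first) and m(u,last); those of X w are m(last,first)⁻¹ m(last,w)
  -- and m(first,last)⁻¹ m(first,w). With these the expansion is the definition of `_⊙_`.
  outer-pivot : Pivot pairing first last
  outer-pivot = record { unit = fl ; unitʳ = lf ; expand = expanded }
    where
    fl : IsUnit R (pairing first last)
    fl = unit-cong (sym pairing-first-last) (Pivot.unit (M-pivot root))
    lf : IsUnit R (pairing last first)
    lf = unit-cong (sym pairing-last-first) (Pivot.unitʳ (M-pivot root))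
    -first : ∀ u → pairing u first ≈ proj₁ (Y u)
    -first u = trans (reflexive (≡.cong (Y u ⊙_) X-first))
      (trans (+-cong (*-identityʳ _) (zeroʳ _)) (+-identityʳ _))
    -last : ∀ u → pairing u last ≈ proj₂ (Y u)
    -last u = trans (reflexive (≡.cong (Y u ⊙_) X-last))
      (trans (+-cong (zeroʳ _) (*-identityʳ _)) (+-identityˡ _))
    first- : ∀ w → pairing first w ≈ pairing first last * proj₂ (X w)
    first- w = trans (reflexive (≡.cong (_⊙ X w) Y-first))
      (trans (+-cong (zeroˡ _) refl) (trans (+-identityˡ _) (*-congʳ (sym pairing-first-last))))
    last- : ∀ w → pairing last w ≈ pairing last first * proj₁ (X w)
    last- w = trans (reflexive (≡.cong (_⊙ X w) Y-last))
      (trans (+-cong refl (zeroˡ _)) (trans (+-identityʳ _) (*-congʳ (sym pairing-last-first))))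
    expanded : ∀ u w → pairing u w ≈ pairing u first * inv R lf * pairing last w +
      pairing u last * inv R fl * pairing first w
    expanded u w = sym (+-cong
      (trans (*-cong (*-congʳ (-first u)) (last- w))
        (trans (sym (*-assoc _ _ _)) (*-congʳ (cancelʳ lf _))))
      (trans (*-cong (*-congʳ (-last u)) (first- w))
        (trans (sym (*-assoc _ _ _)) (*-congʳ (cancelʳ fl _)))))

  module _ (agree : ∀ α β {i k} (i∈α : i ∈ P α) (k∈α : k ∈ P α) (i∈β : i ∈ P β) (k∈β : k ∈ P β)
                    (i<k : i < k) → D (chord i<k) →
                    M α (vertex i i∈α) (vertex k k∈α) ≈ M β (vertex i i∈β) (vertex k k∈β) ×
                    M α (vertex k k∈α) (vertex i i∈α) ≈ M β (vertex k k∈β) (vertex i i∈β)) where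

    -- The ends of the arc of α also lie in the wider part across it, where the values are already
    -- known; compatibility on the shared diagonal carries them over to α.
    realises : ∀ α → Realises α
    realises α = descend α (<-wellFounded (n ∸ width α))
      where
      descend : ∀ α → Acc ℕ._<_ (n ∸ width α) → Realises α
      descend α (acc rs) with above α
      ... | inj₁ (lo≡ , hi≡) = ≡.subst Realises
        (part-unique (≡.trans lo-root (≡.sym lo≡)) (≡.trans hi-root (≡.sym hi≡))) root-realises
      ... | inj₂ (d , β , lo∈β , hi∈β , wider) = realises-from-base α
        (trans (β-realises lo∈β lo∈β) (M-diag β _))
        (trans (β-realises hi∈β hi∈β) (M-diag β _))
        (trans (β-realises lo∈β hi∈β) (proj₁ agreement))
        (trans (β-realises hi∈β lo∈β) (proj₂ agreement))
        where
        β-realises : Realises β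
        β-realises = descend β (rs (ℕ.∸-monoʳ-< wider (width≤n β)))
        agreement = agree β α lo∈β hi∈β (lo∈ α) (hi∈ α) (lo<hi α) d

    some-part : ∀ i → ∃[ α ] i ∈ P α
    some-part i with position i
    ... | is-first i≡first = root , ≡.subst (_∈ P root) (≡.trans lo-root (≡.sym i≡first)) (lo∈ root)
    ... | is-last i≡last   = root , ≡.subst (_∈ P root) (≡.trans hi-root (≡.sym i≡last)) (hi∈ root)
    ... | is-inner α (i∈ , _) = α , i∈

    pairing-diag : ∀ i → pairing i i ≈ 0#
    pairing-diag i = let α , i∈ = some-part i in trans (realises α i∈ i∈) (M-diag α _)

    pivots-of : ∀ α {p q} → p ∈ P α → Pivot pairing p q →
                ∀ {i j} → i ∈ P α → j ∈ P α → i ≢ j → Pivot pairing i j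
    pivots-of α p∈ pq = pivots pairing pairing-diag (realises-unit (realises α)) Fin._≟_ p∈ pq

    -- The pivot of the wider part β is exchanged for the arc of α inside β, where the values
    -- between distinct vertices are units.
    base-pivot : ∀ α → Pivot pairing (lo α) (hi α)
    base-pivot α = descend α (<-wellFounded (n ∸ width α))
      where
      descend : ∀ α → Acc ℕ._<_ (n ∸ width α) → Pivot pairing (lo α) (hi α)
      descend α (acc rs) with above α
      ... | inj₁ (lo≡ , hi≡) = ≡.subst₂ (Pivot pairing) (≡.sym lo≡) (≡.sym hi≡) outer-pivot
      ... | inj₂ (_ , β , lo∈β , hi∈β , wider) = pivots-of β (lo∈ β)
        (descend β (rs (ℕ.∸-monoʳ-< wider (width≤n β)))) lo∈β hi∈β (Fin.<⇒≢ (lo<hi α))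

    part-pivot : ∀ α {i j} → i ∈ P α → j ∈ P α → i ≢ j → Pivot pairing i j
    part-pivot α = pivots-of α (lo∈ α) (base-pivot α)

infix 4 _≟ᵈ_

_≟ᵈ_ : ∀ {n} {S : Subset n} (d e : Diagonal S) → Dec (d ≡ e)
d ≟ᵈ e = map′ (λ { (≡.refl , ≡.refl) → ≡.refl }) (λ { ≡.refl → ≡.refl , ≡.refl })
  (src d ≟ src e ×-dec tgt d ≟ tgt e)

symmetricSet? : ∀ {n κ} {S : Subset n} (tv : Fin κ → Diagonal S) d → Dec (SymmetricSet tv d)
symmetricSet? tv d = Fin.any? λ α → d ≟ᵈ tv α ⊎-dec d ≟ᵈ reverse (tv α)

-- The glued map: uniqueness, weak frieze relations, and the unit case

module Glued {a ℓ} (R : Ring a ℓ) {n : ℕ} (3≤n : 3 ℕ.≤ n) {D : Pred (Diagonal {n} ⊤) 0ℓ}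
             (D? : ∀ d → Dec (D d)) (dissection : IsDissection D)
             {m : ℕ} {P : Fin m → Subset n} (divides : DividesInto D P)
             (cs : ∀ α → Diagonal (P α) → Ring.Carrier R)
             (friezes : ∀ α → IsFrieze R (cs α)) where

  open Ring R
  open SignedMatrices R
  open IsDissection dissection using (reverse-closed)
  open Arcs 3≤n D? dissection
  open Parts 3≤n D? dissection divides

  private
    signed-cs : ∀ α → Vertex (P α) → Vertex (P α) → Carrier
    signed-cs α = signed (cs α)

    signed-cs-diag : ∀ α i → signed-cs α i i ≈ 0#
    signed-cs-diag α = signed-diag (cs α)

    signed-cs-pivot : ∀ α {i j} → i ≢ j → Pivot (signed-cs α) i j
    signed-cs-pivot α = frieze⇒pivot (cs α) (friezes α)

  open Gluing R 3≤n D? dissection divides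
    signed-cs signed-cs-diag signed-cs-pivot

  chord-in-part : ∀ {j l} .(j≢l : ⟨ j ⟩ ≢ ⟨ l ⟩) → D (diagonal ⟨ j ⟩ ⟨ l ⟩ j≢l) → ∃[ α ] j ∈ P α ×
    l ∈ P α
  chord-in-part {j} {l} j≢l d with Fin.<-cmp j l
  ... | tri≈ _ j≡l _ = ⊥-elim (recompute-≢ j≢l (vertex-≡ j≡l))
  ... | tri< j<l _ _ =
    let α , ∈α , _ = part-containing (j<l , inj₂ d) in
    α , ∈α (visible-src (ℕ.<⇒≤ j<l)) , ∈α (visible-tgt (ℕ.<⇒≤ j<l))
  ... | tri> _ _ l<j =
    let α , ∈α , _ = part-containing (l<j , inj₂ (reverse-closed _ d)) in
    α , ∈α (visible-tgt (ℕ.<⇒≤ l<j)) , ∈α (visible-src (ℕ.<⇒≤ l<j))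

  separated-cross : ∀ {u w t v} (u≢w : ⟨ u ⟩ ≢ ⟨ w ⟩) (t<v : t < v) → t < u → u < v → w < t ⊎
    v < w →
                    Cross (diagonal ⟨ u ⟩ ⟨ w ⟩ u≢w) (chord t<v) ×
                    Cross (diagonal ⟨ w ⟩ ⟨ u ⟩ (u≢w ∘ ≡.sym)) (chord t<v)
  separated-cross u≢w t<v t<u u<v (inj₁ w<t) =
    inj₂ (inj₂ (inj₂ (w<u , u<v)) , inj₂ (inj₁ (w<t , t<u))) ,
    inj₁ (inj₁ (w<t , t<u) , inj₁ (w<u , u<v))
    where w<u = ℕ.<-trans w<t t<u
  separated-cross u≢w t<v t<u u<v (inj₂ v<w) =
    inj₂ (inj₁ (u<v , v<w) , inj₂ (inj₂ (t<u , u<w))) ,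
    inj₁ (inj₂ (inj₁ (t<u , u<w)) , inj₂ (inj₁ (u<v , v<w)))
    where u<w = ℕ.<-trans u<v v<w

  module _ {c c′ : Diagonal {n} ⊤ → Carrier}
           (gluing : IsGluing R D P cs c) (gluing′ : IsGluing R D P cs c′) where

    open IsGluing

    -- Both orders are carried along because the induction descends in either vertex and swaps the
    -- two.
    Same : Fin n → Fin n → Set ℓ
    Same u w = entry R c ⟨ u ⟩ ⟨ w ⟩ ≈ entry R c′ ⟨ u ⟩ ⟨ w ⟩ × entry R c ⟨ w ⟩ ⟨ u ⟩ ≈
      entry R c′ ⟨ w ⟩ ⟨ u ⟩

    same-refl : ∀ u → Same u u
    same-refl u = e , e
      where e = trans (entry-diag c ⟨ u ⟩) (sym (entry-diag c′ ⟨ u ⟩))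

    same-entry : ∀ {u w} (u≢w : ⟨ u ⟩ ≢ ⟨ w ⟩) → c (diagonal ⟨ u ⟩ ⟨ w ⟩ u≢w) ≈
      c′ (diagonal ⟨ u ⟩ ⟨ w ⟩ u≢w) →
                 entry R c ⟨ u ⟩ ⟨ w ⟩ ≈ entry R c′ ⟨ u ⟩ ⟨ w ⟩
    same-entry u≢w e = trans (reflexive (entry-≢ c u≢w))
      (trans e (reflexive (≡.sym (entry-≢ c′ u≢w))))

    same-on-part : ∀ α {i k} (i∈ : i ∈ P α) (k∈ : k ∈ P α) .(i≢k : vertex i i∈ ≢ vertex k k∈) →
                   let d = diagonal (vertex i i∈) (vertex k k∈) i≢k in c (embed d) ≈ c′ (embed d)
    same-on-part α i∈ k∈ i≢k = trans (restricts gluing α d) (sym (restricts gluing′ α d))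
      where d = diagonal (vertex _ i∈) (vertex _ k∈) i≢k

    same-together : ∀ α {i k} → i ∈ P α → k ∈ P α → Same i k
    same-together α {i} {k} i∈ k∈ = cases (i Fin.≟ k)
      where
      cases : Dec (i ≡ k) → Same i k
      cases (yes ≡.refl) = same-refl i
      cases (no  i≢k)    =
        same-entry (i≢k ∘ ≡.cong label) (same-on-part α i∈ k∈ (i≢k ∘ ≡.cong label)) ,
        same-entry (i≢k ∘ ≡.sym ∘ ≡.cong label) (same-on-part α k∈ i∈ (i≢k ∘ ≡.sym ∘ ≡.cong label))

    same-crossing : ∀ α {u w} (u≢w : ⟨ u ⟩ ≢ ⟨ w ⟩) → D (chord (lo<hi α)) →
                    Cross (diagonal ⟨ u ⟩ ⟨ w ⟩ u≢w) (chord (lo<hi α)) →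
                    Same u (lo α) → Same u (hi α) → Same (lo α) w → Same (hi α) w →
                    entry R c ⟨ u ⟩ ⟨ w ⟩ ≈ entry R c′ ⟨ u ⟩ ⟨ w ⟩
    same-crossing α u≢w d x ul uh lw hw = same-entry u≢w
      (trans (exchange _ (chord (lo<hi α)) x d (reverse-closed _ d))
        (trans (+-cong (*₃-cong (proj₁ ul) (inv-cong (unit _ (reverse-closed _ d))
          (unit′ _ (reverse-closed _ d)) lo-hi) (proj₁ hw))
            (*₃-cong (proj₁ uh) (inv-cong (unit _ d) (unit′ _ d) hi-lo) (proj₁ lw)))
          (sym (exchange′ _ (chord (lo<hi α)) x d (reverse-closed _ d)))))
      where
      open IsWeakFrieze (weakFrieze gluing)
      open IsWeakFrieze (weakFrieze gluing′) renaming (exchange to exchange′; unit to unit′)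
      lo-hi : c (reverse (chord (lo<hi α))) ≈ c′ (reverse (chord (lo<hi α)))
      lo-hi = same-on-part α (hi∈ α) (lo∈ α) (loᵛ≢hiᵛ α ∘ ≡.sym)
      hi-lo : c (chord (lo<hi α)) ≈ c′ (chord (lo<hi α))
      hi-lo = same-on-part α (lo∈ α) (hi∈ α) (loᵛ≢hiᵛ α)

    -- The weak frieze relation across the arc of the cell around `u` expresses both values through
    -- pairs within that cell, where the given frieze decides, and through pairs of an end of the
    -- arc with `w`. These ends precede `u` in `_≺_`.
    same-separated : ∀ {u w} → Separated u w → (∀ {j} → j ≺ u → Same j w) → Same u w
    same-separated {u} {w} (α , inner-u@(u∈ , lo<u , u<hi) , d , w-out) ih =
      same-crossing α u≢w d (proj₁ crossing) u–lo u–hi lo–w hi–w ,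
      same-crossing α (u≢w ∘ ≡.sym) d (proj₂ crossing) (swap× lo–w) (swap× hi–w) (swap× u–lo)
        (swap× u–hi)
      where
      u≢w : ⟨ u ⟩ ≢ ⟨ w ⟩
      u≢w e = not-outside (≡.cong label e) w-out
        where
        not-outside : u ≡ w → ¬ (w < lo α ⊎ hi α < w)
        not-outside ≡.refl (inj₁ w<lo) = ℕ.<-asym lo<u w<lo
        not-outside ≡.refl (inj₂ hi<w) = ℕ.<-asym u<hi hi<w
      crossing = separated-cross u≢w (lo<hi α) lo<u u<hi w-out
      u–lo = same-together α u∈ (lo∈ α)
      u–hi = same-together α u∈ (hi∈ α)
      lo–w = ih (α , inner-u , inj₁ ≡.refl)
      hi–w = ih (α , inner-u , inj₂ ≡.refl)

    same-step : ∀ {u w} → u < w → (∀ {j} → j ≺ u → Same j w) → (∀ {j} → j ≺ w → Same u j) → Same u w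
    same-step {u} {w} u<w ih-u ih-w = cases (together-or-separated u<w)
      where
      cases : Together u w ⊎ Separated u w ⊎ Separated w u → Same u w
      cases (inj₁ (α , u∈ , w∈)) = same-together α u∈ w∈
      cases (inj₂ (inj₁ sep))    = same-separated sep ih-u
      cases (inj₂ (inj₂ sep))    = swap× (same-separated sep (swap× ∘ ih-w))

    -- Each recursive call shrinks one of the two accessibility proofs and keeps the other.
    same : ∀ u w → Acc _≺_ u → Acc _≺_ w → Same u w
    same u w (acc rs) (acc rs′) with Fin.<-cmp u w
    ... | tri< u<w _ _ = same-step u<w (λ j≺u → same _ w (rs j≺u) (acc rs′))
      (λ j≺w → same u _ (acc rs) (rs′ j≺w))
    ... | tri≈ _ ≡.refl _ = same-refl u
    ... | tri> _ _ w<u = swap× (same-step w<u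
      (λ j≺w → swap× (same u _ (acc rs) (rs′ j≺w))) (λ j≺u → swap× (same _ w (rs j≺u) (acc rs′))))

    gluing-unique : ∀ d → c d ≈ c′ d
    gluing-unique (diagonal u w u≢w) = trans (reflexive (≡.sym (entry-≢ c u≢w′)))
      (trans (proj₁ (same (label u) (label w) (≺-wellFounded _) (≺-wellFounded _)))
        (reflexive (entry-≢ c′ u≢w′)))
      where
      u≢w′ : u ≢ w
      u≢w′ = recompute-≢ u≢w

  agree : Compatible R D P cs →
          ∀ α β {i k} (i∈α : i ∈ P α) (k∈α : k ∈ P α) (i∈β : i ∈ P β) (k∈β : k ∈ P β) (i<k : i < k)
            → D (chord i<k) →
          signed (cs α) (vertex i i∈α) (vertex k k∈α) ≈
            signed (cs β) (vertex i i∈β) (vertex k k∈β) ×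
          signed (cs α) (vertex k k∈α) (vertex i i∈α) ≈ signed (cs β) (vertex k k∈β) (vertex i i∈β)
  agree compatible α β {i} {k} i∈α k∈α i∈β k∈β i<k d =
    agree-at i∈α k∈α i∈β k∈β (Fin.<⇒≢ i<k) d ,
    agree-at k∈α i∈α k∈β i∈β (Fin.<⇒≢ i<k ∘ ≡.sym) (reverse-closed _ d)
    where
    agree-at : ∀ {i k} (i∈α : i ∈ P α) (k∈α : k ∈ P α) (i∈β : i ∈ P β) (k∈β : k ∈ P β)
               (i≢k : i ≢ k) → D (diagonal ⟨ i ⟩ ⟨ k ⟩ (i≢k ∘ ≡.cong label)) →
               signed (cs α) (vertex i i∈α) (vertex k k∈α) ≈
                 signed (cs β) (vertex i i∈β) (vertex k k∈β)
    agree-at {i} {k} i∈α k∈α i∈β k∈β i≢k d = ·-cong (sgn i k)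
      (trans (reflexive (entry-≢ (cs α) (i≢k ∘ ≡.cong label)))
        (trans (compatible α β (diagonal (vertex i i∈α) (vertex k k∈α) (i≢k ∘ ≡.cong label))
                 (diagonal (vertex i i∈β) (vertex k k∈β) (i≢k ∘ ≡.cong label)) ≡.refl d)
          (reflexive (≡.sym (entry-≢ (cs β) (i≢k ∘ ≡.cong label))))))

  glued : Diagonal {n} ⊤ → Carrier
  glued (diagonal i k _) = vertexSgn i k · pairing (label i) (label k)

  module _ (compatible : Compatible R D P cs) where

    private
      agreement = agree compatible

    signed-glued : ∀ i k → pairing (label i) (label k) ≈ signed glued i k
    signed-glued i k = cases (i ≟ k)
      where
      cases : Dec (i ≡ k) → pairing (label i) (label k) ≈ signed glued i k
      cases (yes ≡.refl) = trans (pairing-diag agreement (label i)) (sym (signed-diag glued i))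
      cases (no  i≢k)    = sym (trans (·-cong (vertexSgn i k) (reflexive (entry-≢ glued i≢k)))
                                      (·-involutive (vertexSgn i k) _))

    pivot-glued : ∀ {i k} → Pivot pairing (label i) (label k) → Pivot (signed glued) i k
    pivot-glued {i} {k} p = pivot-cong signed-glued record
      { unit = Pivot.unit p ; unitʳ = Pivot.unitʳ p ; expand = λ u w →
        Pivot.expand p (label u) (label w) }

    glued-restricts : ∀ α (d : Diagonal (P α)) → glued (embed d) ≈ cs α d
    glued-restricts α (diagonal i k i≢k) =
      trans (·-cong (vertexSgn i k) (realises agreement α (member i) (member k)))
        (trans (·-involutive (vertexSgn i k) _) (reflexive (entry-≢ (cs α) (recompute-≢ i≢k))))

    -- A diagonal of `D` has both ends in the part below it, whose pairs are all pivots. A pivot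
    -- yields the exchange relation for every diagonal crossing it, whether or not the value there
    -- is a unit.
    glued-pivot : ∀ {i k} (i≢k : i ≢ k) → D (diagonal i k i≢k) → Pivot (signed glued) i k
    glued-pivot {vertex i _} {vertex k _} i≢k d =
      let α , i∈ , k∈ = chord-in-part i≢k d in
      pivot-glued (part-pivot agreement α i∈ k∈ (i≢k ∘ vertex-≡))

    glued-weakFrieze : IsWeakFrieze R glued D
    glued-weakFrieze = record
      { unit = unit
      ; exchange = λ { (diagonal i k i≢k) (diagonal j l j≢l) x e e′ →
          let j≢l = recompute-≢ j≢l
              p = glued-pivot j≢l e
          in expand⇒exchange glued j≢l (unit _ e′) (unit _ e) (Pivot.unitʳ p) (Pivot.unit p)
               (recompute-≢ i≢k) x (Pivot.expand p i k) }
      }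
      where
      unit : ∀ d → D d → IsUnit R (glued d)
      unit (diagonal i k i≢k) d =
        unit-cong (·-involutive (vertexSgn i k) _)
          (unit-· (vertexSgn i k) (unit-cong (·-cong (vertexSgn i k)
            (reflexive (entry-≢ glued (recompute-≢ i≢k))))
            (Pivot.unit (glued-pivot (recompute-≢ i≢k) d))))

    glued-gluing : IsGluing R D P cs glued
    glued-gluing = record { restricts = glued-restricts ; weakFrieze = glued-weakFrieze }

    -- By uniqueness `c` agrees with `glued`, so (first,last) is a pivot of its signed matrix. With
    -- units everywhere, pivots can be exchanged without restriction to a part.
    unit-gluing-frieze : ∀ c → IsGluing R D P cs c → (∀ d → IsUnit R (c d)) → IsFrieze R c
    unit-gluing-frieze c gluing units = pivots⇒frieze c units λ i≢j →
      pivots (signed c) (signed-diag c) {W = λ _ → ⊤ₜ} (λ _ _ → signed-unit c units) _≟_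
        {⟨ first ⟩} {⟨ last ⟩} tt
        (pivot-cong signed-≈ (pivot-glued outer-pivot)) tt tt i≢j
      where
      signed-≈ : ∀ i k → signed glued i k ≈ signed c i k
      signed-≈ i k = ·-cong (vertexSgn i k)
        (proj₁ (same glued-gluing gluing (label i) (label k) (≺-wellFounded _) (≺-wellFounded _)))

theoremD : ∀ {a ℓ} (R : Ring a ℓ) (n : ℕ) → 3 ≤ n →
    (κ : ℕ) (tv : Fin κ → Diagonal {n} ⊤) → PairwiseDistinct tv →
    IsDissection (SymmetricSet tv) →
    (P : Fin (suc κ) → Subset n) → DividesInto (SymmetricSet tv) P →
    (cs : ∀ α → Diagonal (P α) → Ring.Carrier R) →
    (∀ α → IsFrieze R (cs α)) →
    Compatible R (SymmetricSet tv) P cs →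
    ∃! (λ c c′ → ∀ d → Ring._≈_ R (c d) (c′ d)) (IsGluing R (SymmetricSet tv) P cs) ×
    (∀ c → IsGluing R (SymmetricSet tv) P cs c → (∀ d → IsUnit R (c d)) → IsFrieze R c)
theoremD R n 3≤n κ tv _ dissection P divides cs friezes compatible =
  (glued , glued-gluing compatible , gluing-unique (glued-gluing compatible)) ,
    unit-gluing-frieze compatible
  where open Glued R 3≤n (symmetricSet? tv) dissection divides cs friezes
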